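{- Let $\tau=\frac12(1+\sqrt5)$. Then $\mathbb{Z}_{ -\tau}\cap[0,+\infty)=\mathbb{Z}_{\tau^2}\cap[0,+\infty)$, where $\mathbb{Z}_{ -\tau}$ is the set of $(-\tau)$-integers (negative base $-\tau$) and $\mathbb{Z}_{\tau^2}$ is the set of $(\tau^2)$-integers (positive base $\tau^2$).
   Context: Positive base (Rényi expansions). For real $\beta>1$ let $T_\beta:[0,1)\to[0,1)$, $T_\beta(y)=\beta y-\lfloor\beta y\rfloor$, and for $y\in[0,1)$ let $d_\beta(y)=y_1y_2y_3\cdots$ with $y_i=\lfloor\beta T_\beta^{i-1}(y)\rfloor$, so that $y=\sum_{i\ge1}y_i\beta^{ -i}$. For $x\ge0$, the $\beta$-expansion of $x$ is the expression $x=\sum_{i=-\infty}^{k}x_i\beta^i$ ($k\in\mathbb{Z}$) such that $x_kx_{k-1}x_{k-2}\cdots=d_\beta(y)$ for some $y\in[0,1)$; it exists and is unique up to leading zeros. The set $\mathbb{Z}_\beta$ of $\beta$-integers consists of all $x\in\mathbb{R}$ such that the $\beta$-expansion of $|x|$ has $x_i=0$ for all $i<0$. Negative base (Ito–Sadahiro expansions). For real $\beta>1$ put $l_\beta=-\frac{\beta}{\beta+1}$, $r_\beta=1+l_\beta=\frac{1}{\beta+1}$, and define $T_{ -\beta}:[l_\beta,r_\beta)\to[l_\beta,r_\beta)$ by $T_{ -\beta}(y)=-\beta y-\lfloor-\beta y-l_\beta\rfloor$. For $y\in[l_\beta,r_\beta)$ put $d_{ -\beta}(y)=y_1y_2y_3\cdots$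 where $y_i=\lfloor-\beta T_{ -\beta}^{i-1}(y)-l_\beta\rfloor$ for $i\ge1$; then $y=\sum_{i\ge1}y_i(-\beta)^{ -i}$. For $x\in\mathbb{R}$, the $(-\beta)$-expansion of $x$ is the expression $x=\sum_{i=-\infty}^{k}x_i(-\beta)^i$ ($k\in\mathbb{Z}$) such that $x_kx_{k-1}x_{k-2}\cdots=d_{ -\beta}(y)$ for some $y$ in the open interval $(l_\beta,r_\beta)$; it exists and is unique up to leading zeros. The set $\mathbb{Z}_{ -\beta}$ of $(-\beta)$-integers consists of all $x\in\mathbb{R}$ whose $(-\beta)$-expansion has $x_i=0$ for all $i<0$. -}

module Defs where

open import Algebra.Apartness.Bundles using (HeytingField; HeytingCommutativeRing)
open import Algebra.Bundles using (CommutativeRing; Semiring)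
import Algebra.Apartness.Properties.HeytingCommutativeRing as HeytingProperties
import Algebra.Definitions.RawSemiring as RawSemiringDefinitions
import Algebra.Properties.Ring as RingProperties
open import Data.Empty using (⊥-elim)
open import Data.Integer.Base as ℤ using (ℤ; +_; -[1+_]; 0ℤ)
open import Data.Nat.Base as ℕ using (ℕ; zero; suc)
open import Data.Product.Base using (Σ-syntax; ∃-syntax; _×_; _,_; proj₁; proj₂)
open import Data.Sum.Base using (_⊎_; inj₁; inj₂; [_,_]′)
open import Level using (Level) renaming (_⊔_ to _⊔ˡ_; suc to lsuc)
open import Relation.Binary.Core using (Rel)
open import Relation.Binary.Lattice.Definitions using (Supremum)
open import Relation.Binary.PropositionalEquality.Core using (_≡_)
open import Relation.Binary.Structures using (IsStrictPartialOrder)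
import Relation.Binary.Reasoning.Setoid as SetoidReasoning
open import Relation.Nullary.Negation using (¬_)
open import Relation.Unary using (Pred)

-- The real numbers, axiomatised as an Archimedean, Cauchy-complete ordered
-- field.  Classically these axioms determine ℝ up to unique isomorphism.  They
-- are phrased so that they are also constructively meaningful: the order is not
-- assumed decidable, `_≤_` is the negation of the reverse strict order, and
-- binary maxima (needed for absolute values) are part of the structure.
record RealField (c ℓ₁ ℓ₂ : Level) : Set (lsuc (c ⊔ˡ ℓ₁ ⊔ˡ ℓ₂)) where
  infix  4 _<_ _≤_ _⟶_
  infixl 6 _⊔_
  field
    heytingField : HeytingField c ℓ₁ ℓ₂

  open HeytingField heytingField public

  commutativeRing : CommutativeRing c ℓ₁
  commutativeRing = HeytingCommutativeRing.commutativeRing heytingCommutativeRing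

  open RawSemiringDefinitions
    (Semiring.rawSemiring (CommutativeRing.semiring commutativeRing)) public
    using (_^_) renaming (_×_ to _×ₙ_)

  field
    _<_                  : Rel Carrier ℓ₂
    isStrictPartialOrder : IsStrictPartialOrder _≈_ _<_
    <⇒#                  : ∀ {x y} → x < y → x # y
    #⇒<⊎>                : ∀ {x y} → x # y → x < y ⊎ y < x
    +-monoˡ-<            : ∀ z {x y} → x < y → x + z < y + z
    *-pos                : ∀ {x y} → 0# < x → 0# < y → 0# < x * y

  module < = IsStrictPartialOrder isStrictPartialOrder

  _≤_ : Rel Carrier ℓ₂
  x ≤ y = ¬ (y < x)

  field
    _⊔_        : Carrier → Carrier → Carrier
    ⊔-supremum : Supremum _≤_ _⊔_

  ∣_∣ : Carrier → Carrier
  ∣ x ∣ = x ⊔ (- x)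

  _⟶_ : (ℕ → Carrier) → Carrier → Set (c ⊔ˡ ℓ₂)
  s ⟶ x = ∀ ε → 0# < ε → ∃[ N ] ∀ n → N ℕ.≤ n → ∣ s n - x ∣ < ε

  IsCauchy : (ℕ → Carrier) → Set (c ⊔ˡ ℓ₂)
  IsCauchy s =
    ∀ ε → 0# < ε → ∃[ N ] ∀ m n → N ℕ.≤ m → N ℕ.≤ n → ∣ s m - s n ∣ < ε

  field
    archimedean : ∀ x → ∃[ n ] x < n ×ₙ 1#
    complete    : ∀ s → IsCauchy s → ∃[ x ] s ⟶ x

module Expansions {c ℓ₁ ℓ₂} (ℝ : RealField c ℓ₁ ℓ₂) where

  open RealField ℝ public

  private
    module CR = CommutativeRing commutativeRing
    open RingProperties CR.ring
      using (-‿distribˡ-*; -‿distribʳ-*; -‿involutive; -0#≈0#)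
    open HeytingProperties heytingCommutativeRing using (1#0; x-0≈x)
    open SetoidReasoning CR.setoid

  fromℤ : ℤ → Carrier
  fromℤ (+ n)    = n ×ₙ 1#
  fromℤ -[1+ n ] = - (suc n ×ₙ 1#)

  -- The witness of `#⇒invertible` inverts x - 0#, which is equal to x.
  inv : ∀ x → x # 0# → Carrier
  inv x x#0 = proj₁ (#⇒invertible x#0)

  zpow : ∀ b → b # 0# → ℤ → Carrier
  zpow b b#0 (+ n)    = b ^ n
  zpow b b#0 -[1+ n ] = inv b b#0 ^ suc n

  partialSum : (ℕ → Carrier) → ℕ → Carrier
  partialSum a zero    = 0#
  partialSum a (suc n) = partialSum a n + a n

  HasSum : (ℕ → Carrier) → Carrier → Set (c ⊔ˡ ℓ₂)
  HasSum a x = partialSum a ⟶ x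

  <-cotrans : ∀ {x y} → x < y → ∀ z → x < z ⊎ z < y
  <-cotrans x<y z with #-cotrans (<⇒# x<y) z
  ... | inj₁ x#z = [ inj₁ , (λ z<x → inj₂ (<.trans z<x x<y)) ]′ (#⇒<⊎> x#z)
  ... | inj₂ z#y = [ inj₂ , (λ y<z → inj₁ (<.trans x<y y<z)) ]′ (#⇒<⊎> z#y)

  <-respˡ : ∀ {x y z} → x ≈ y → x < z → y < z
  <-respˡ = <.<-respˡ-≈

  <-respʳ : ∀ {x y z} → x ≈ y → z < x → z < y
  <-respʳ = <.<-respʳ-≈

  x<y⇒0<y-x : ∀ {x y} → x < y → 0# < y - x
  x<y⇒0<y-x {x} x<y = <-respˡ (CR.-‿inverseʳ x) (+-monoˡ-< (- x) x<y)

  y-x+x≈y : ∀ y x → (y - x) + x ≈ y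
  y-x+x≈y y x = begin
    (y - x) + x   ≈⟨ CR.+-assoc y (- x) x ⟩
    y + (- x + x) ≈⟨ CR.+-congˡ (CR.-‿inverseˡ x) ⟩
    y + 0#        ≈⟨ CR.+-identityʳ y ⟩
    y             ∎

  0<y-x⇒x<y : ∀ {x y} → 0# < y - x → x < y
  0<y-x⇒x<y {x} {y} p =
    <-respˡ (CR.+-identityˡ x) (<-respʳ (y-x+x≈y y x) (+-monoˡ-< x p))

  x<0⇒0<-x : ∀ {x} → x < 0# → 0# < - x
  x<0⇒0<-x {x} p = <-respʳ (CR.+-identityˡ (- x)) (x<y⇒0<y-x p)

  0<x⇒-x<0 : ∀ {x} → 0# < x → - x < 0#
  0<x⇒-x<0 {x} p = <-respˡ (CR.+-identityˡ (- x))
                     (<-respʳ (CR.-‿inverseʳ x) (+-monoˡ-< (- x) p))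

  0<x+y : ∀ {x y} → 0# < x → 0# < y → 0# < x + y
  0<x+y {x} {y} p q =
    <.trans q (<-respˡ (CR.+-identityˡ y) (+-monoˡ-< y p))

  0<1 : 0# < 1#
  0<1 with #⇒<⊎> 1#0
  ... | inj₂ p = p
  ... | inj₁ p = <-respʳ eq (*-pos (x<0⇒0<-x p) (x<0⇒0<-x p))
    where
    eq : - 1# * - 1# ≈ 1#
    eq = begin
      - 1# * - 1#     ≈⟨ -‿distribˡ-* 1# (- 1#) ⟨
      - (1# * - 1#)   ≈⟨ CR.-‿cong (CR.*-identityˡ (- 1#)) ⟩
      - - 1#          ≈⟨ -‿involutive 1# ⟩
      1#              ∎

  pos⇒#0 : ∀ {x} → 0# < x → x # 0#
  pos⇒#0 p = #-sym (<⇒# p)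

  1<β⇒0<β : ∀ {β} → 1# < β → 0# < β
  1<β⇒0<β = <.trans 0<1

  β#0 : ∀ {β} → 1# < β → β # 0#
  β#0 1<β = pos⇒#0 (1<β⇒0<β 1<β)

  -β#0 : ∀ {β} → 1# < β → - β # 0#
  -β#0 1<β = <⇒# (0<x⇒-x<0 (1<β⇒0<β 1<β))

  β+1#0 : ∀ {β} → 1# < β → β + 1# # 0#
  β+1#0 1<β = pos⇒#0 (0<x+y (1<β⇒0<β 1<β) 0<1)

  *-monoʳ-< : ∀ {x y z} → 0# < z → x < y → z * x < z * y
  *-monoʳ-< {x} {y} {z} 0<z x<y =
    0<y-x⇒x<y (<-respʳ eq (*-pos 0<z (x<y⇒0<y-x x<y)))
    where
    eq : z * (y - x) ≈ z * y - z * x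
    eq = trans (CR.distribˡ z y (- x)) (CR.+-congˡ (sym (-‿distribʳ-* z x)))

  1<x*y : ∀ {x y} → 1# < x → 1# < y → 1# < x * y
  1<x*y {x} p q =
    <.trans p (<-respˡ (CR.*-identityʳ x) (*-monoʳ-< (1<β⇒0<β p) q))

  -- n = ⌊ x ⌋.  The floor is not a computable function on the reals, so this
  -- and the transformations built on it are given by their graphs.
  IsFloor : Carrier → ℤ → Set ℓ₂
  IsFloor x n = fromℤ n ≤ x × x < fromℤ (ℤ.suc n)

  -- For a base b and a relation Digit y n ("n is the first digit of y"), the
  -- transformation is T y = b y - n, t i is T^i y, and the zero-based d i is the
  -- digit y_{i+1}, that is, the first digit of T^i y.
  IsDigitSequence : (b : Carrier) → (Carrier → ℤ → Set ℓ₂) →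
                    Carrier → (ℕ → ℤ) → Set (c ⊔ˡ ℓ₁ ⊔ˡ ℓ₂)
  IsDigitSequence b Digit y d =
    Σ[ t ∈ (ℕ → Carrier) ]
      t 0 ≈ y ×
      (∀ i → Digit (t i) (d i) × t (suc i) ≈ b * t i - fromℤ (d i))

  -- An expansion x = Σ_{i ≤ k} x_i b^i with x_k x_{k-1} … the digit sequence of
  -- some y in the given domain; digit j is the coefficient x_{k-j}.
  record Expansion (b : Carrier) (b#0 : b # 0#)
                   (Domain : Pred Carrier ℓ₂)
                   (IsDigits : Carrier → (ℕ → ℤ) → Set (c ⊔ˡ ℓ₁ ⊔ˡ ℓ₂))
                   (x : Carrier) : Set (c ⊔ˡ ℓ₁ ⊔ˡ ℓ₂) where
    field
      k        : ℤ
      digit    : ℕ → ℤ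
      y        : Carrier
      y∈Domain : Domain y
      isDigits : IsDigits y digit
      hasSum   : HasSum (λ j → fromℤ (digit j) * zpow b b#0 (k ℤ.- + j)) x

    IsIntegral : Set
    IsIntegral = ∀ j → k ℤ.- + j ℤ.< 0ℤ → digit j ≡ 0ℤ

  module Positive (β : Carrier) (1<β : 1# < β) where

    Domain : Pred Carrier ℓ₂
    Domain y = 0# ≤ y × y < 1#

    IsDβ : Carrier → (ℕ → ℤ) → Set (c ⊔ˡ ℓ₁ ⊔ˡ ℓ₂)
    IsDβ = IsDigitSequence β (λ y n → IsFloor (β * y) n)

    βExpansion : Carrier → Set (c ⊔ˡ ℓ₁ ⊔ˡ ℓ₂)
    βExpansion = Expansion β (β#0 1<β) Domain IsDβ

    βIntegers : Pred Carrier (c ⊔ˡ ℓ₁ ⊔ˡ ℓ₂)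
    βIntegers x = Σ[ e ∈ βExpansion ∣ x ∣ ] Expansion.IsIntegral e

  module Negative (β : Carrier) (1<β : 1# < β) where

    lβ rβ : Carrier
    lβ = - (β * inv (β + 1#) (β+1#0 1<β))
    rβ = 1# + lβ

    -- Open at the left end, unlike the domain [lβ , rβ) of the transformation.
    Domain : Pred Carrier ℓ₂
    Domain y = lβ < y × y < rβ

    IsD-β : Carrier → (ℕ → ℤ) → Set (c ⊔ˡ ℓ₁ ⊔ˡ ℓ₂)
    IsD-β = IsDigitSequence (- β) (λ y n → IsFloor (- β * y - lβ) n)

    -βExpansion : Carrier → Set (c ⊔ˡ ℓ₁ ⊔ˡ ℓ₂)
    -βExpansion = Expansion (- β) (-β#0 1<β) Domain IsD-β

    -βIntegers : Pred Carrier (c ⊔ˡ ℓ₁ ⊔ˡ ℓ₂)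
    -βIntegers x = Σ[ e ∈ -βExpansion x ] Expansion.IsIntegral e

  ℤ[_,_] : ∀ β → 1# < β → Pred Carrier (c ⊔ˡ ℓ₁ ⊔ˡ ℓ₂)
  ℤ[ β , 1<β ] = Positive.βIntegers β 1<β

  ℤ[-_,_] : ∀ β → 1# < β → Pred Carrier (c ⊔ˡ ℓ₁ ⊔ˡ ℓ₂)
  ℤ[- β , 1<β ] = Negative.-βIntegers β 1<β

  [0,+∞⟩ : Pred Carrier ℓ₂
  [0,+∞⟩ x = 0# ≤ x

  IsSquareRoot : Carrier → Carrier → Set (ℓ₁ ⊔ˡ ℓ₂)
  IsSquareRoot a s = 0# ≤ s × s * s ≈ a

  2# : Carrier
  2# = 1# + 1#

  0<2 : 0# < 2#
  0<2 = 0<x+y 0<1 0<1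

  ½ : Carrier
  ½ = inv 2# (pos⇒#0 0<2)

  ½*2≈1 : ½ * 2# ≈ 1#
  ½*2≈1 = trans (CR.*-congˡ (sym (x-0≈x 2#)))
                (proj₁ (proj₂ (#⇒invertible (pos⇒#0 0<2))))

  0<½ : 0# < ½
  0<½ with <-cotrans 0<1 ½
  ... | inj₁ 0<½ = 0<½
  ... | inj₂ ½<1 = <-respʳ eq (x<y⇒0<y-x ½<1)
    where
    eq : 1# - ½ ≈ ½
    eq = begin
      1# - ½                  ≈⟨ CR.+-congʳ ½*2≈1 ⟨
      ½ * 2# - ½              ≈⟨ CR.+-congʳ (CR.distribˡ ½ 1# 1#) ⟩
      (½ * 1# + ½ * 1#) - ½   ≈⟨ CR.+-congʳ (CR.+-cong (CR.*-identityʳ ½) (CR.*-identityʳ ½)) ⟩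
      (½ + ½) - ½             ≈⟨ CR.+-assoc ½ ½ (- ½) ⟩
      ½ + (½ - ½)             ≈⟨ CR.+-congˡ (CR.-‿inverseʳ ½) ⟩
      ½ + 0#                  ≈⟨ CR.+-identityʳ ½ ⟩
      ½                       ∎

  x<1+x : ∀ x → x < 1# + x
  x<1+x x = <-respˡ (CR.+-identityˡ x) (+-monoˡ-< x 0<1)

  4≈2*2 : 4 ×ₙ 1# ≈ 2# * 2#
  4≈2*2 = begin
    1# + (1# + (1# + (1# + 0#))) ≈⟨ CR.+-congˡ (CR.+-congˡ (CR.+-congˡ (CR.+-identityʳ 1#))) ⟩
    1# + (1# + 2#)               ≈⟨ CR.+-assoc 1# 1# 2# ⟨
    2# + 2#                      ≈⟨ CR.+-cong (CR.*-identityˡ 2#) (CR.*-identityˡ 2#) ⟨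
    1# * 2# + 1# * 2#            ≈⟨ CR.distribʳ 2# 1# 1# ⟨
    2# * 2#                      ∎

  1<√5 : ∀ {s} → IsSquareRoot (fromℤ (+ 5)) s → 1# < s
  1<√5 {s} (0≤s , s*s≈5) with <-cotrans (x<1+x 1#) s
  ... | inj₁ 1<s = 1<s
  ... | inj₂ s<2 = ⊥-elim (<.asym 5<4 (x<1+x (4 ×ₙ 1#)))
    where
    u = 2# - s

    s+u≈2 : s + u ≈ 2#
    s+u≈2 = trans (CR.+-comm s u) (y-x+x≈y 2# s)

    0<s+2 : 0# < s + 2#
    0<s+2 with <-cotrans (0<x⇒-x<0 0<2) s
    ... | inj₁ -2<s = <-respʳ (CR.+-congˡ (-‿involutive 2#)) (x<y⇒0<y-x -2<s)
    ... | inj₂ s<0  = ⊥-elim (0≤s s<0)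

    eq : u * (s + 2#) + s * s ≈ 2# * 2#
    eq = begin
      u * (s + 2#) + s * s        ≈⟨ CR.+-comm _ _ ⟩
      s * s + u * (s + 2#)        ≈⟨ CR.+-congˡ (CR.distribˡ u s 2#) ⟩
      s * s + (u * s + u * 2#)    ≈⟨ CR.+-assoc _ _ _ ⟨
      (s * s + u * s) + u * 2#    ≈⟨ CR.+-congʳ (CR.+-congˡ (CR.*-comm u s)) ⟩
      (s * s + s * u) + u * 2#    ≈⟨ CR.+-congʳ (CR.distribˡ s s u) ⟨
      s * (s + u) + u * 2#        ≈⟨ CR.+-congʳ (CR.*-congˡ s+u≈2) ⟩
      s * 2# + u * 2#             ≈⟨ CR.distribʳ 2# s u ⟨
      (s + u) * 2#                ≈⟨ CR.*-congʳ s+u≈2 ⟩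
      2# * 2#                     ∎

    5<4 : 5 ×ₙ 1# < 4 ×ₙ 1#
    5<4 = <-respˡ (trans (CR.+-identityˡ _) s*s≈5)
            (<-respʳ (trans eq (sym 4≈2*2))
              (+-monoˡ-< (s * s) (*-pos (x<y⇒0<y-x s<2) 0<s+2)))

  goldenRatio : (√5 : Carrier) → Carrier
  goldenRatio √5 = ½ * (1# + √5)

  1<goldenRatio : ∀ {√5} → IsSquareRoot (fromℤ (+ 5)) √5 → 1# < goldenRatio √5
  1<goldenRatio {√5} r = <-respˡ ½*2≈1 (*-monoʳ-< 0<½ 2<1+√5)
    where
    2<1+√5 : 2# < 1# + √5
    2<1+√5 = <-respʳ (CR.+-comm √5 1#) (+-monoˡ-< 1# (1<√5 r))

{-# OPTIONS --safe #-}

-- Cut and project.  Both sets turn out to be { x ∈ ℤ[τ] : x ≥ 0, 0 ≤ x′ < τ² },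
-- where x ↦ x′ is the conjugation τ ↦ 1 − τ.  Conjugation sends the bases −τ and
-- τ² to τ⁻¹ and τ⁻², so the conjugate of Σ xᵢ bⁱ is a contracting sum, and the
-- admissibility of the digits keeps it in [0 , τ²).  Conversely, expand a point x
-- of the window greedily: the remainder left after the integer digits is an
-- element of ℤ[τ] bounded together with its conjugate, hence 0 or ± τ⁻¹, and the
-- last two are excluded by following the conjugate along the orbit.

module Submission where

open import Algebra.Bundles using (CommutativeRing; RawRing)
import Algebra.Apartness.Properties.HeytingCommutativeRing as HeytingProperties
import Algebra.Properties.AbelianGroup as AbelianGroupProperties
import Algebra.Properties.CommutativeSemiring.Exp as Exp
import Algebra.Properties.Ring as RingProperties
import Algebra.Properties.Semiring.Mult as SemiringMult
import Algebra.Solver.Ring as RingSolver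
open import Algebra.Solver.Ring.AlmostCommutativeRing
  using (fromCommutativeRing; _-Raw-AlmostCommutative⟶_)
open import Data.Empty using (⊥; ⊥-elim)
open import Data.Integer.Base as ℤ
  using (ℤ; +_; -[1+_]; 0ℤ; 1ℤ; -1ℤ; +<+; -<+; -<-; +≤+)
import Data.Integer.Properties as ℤ
import Data.Integer.Tactic.RingSolver as ℤ-RingSolver
open import Data.Maybe.Base using (Maybe; just; nothing)
open import Data.Nat.Base as ℕ using (ℕ; zero; suc; z<s; s<s)
open import Data.Nat.Induction using (<-wellFounded; Acc; acc)
import Data.Nat.Properties as ℕ
open import Data.Product.Base using (Σ-syntax; ∃-syntax; _×_; _,_; proj₁; proj₂; map₂)
open import Data.Sum.Base using (_⊎_; inj₁; inj₂; [_,_]′)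
open import Level using (Level) renaming (_⊔_ to _⊔ˡ_; suc to lsuc)
open import Relation.Binary.PropositionalEquality.Core as ≡ using (_≡_)
import Relation.Binary.Reasoning.Setoid as SetoidReasoning
open import Relation.Nullary.Decidable.Core using (Dec; yes; no; True; toWitness)
open import Relation.Unary using (Pred; _∩_; _≐_)
open import Defs

-- Two obstacles shape the proof. Floors and comparisons are not decidable for constructive reals,
-- so the greedy expansion is carried out inside ℤ[τ], where signs can be computed; both bases are
-- units there, so dividing by a power of the base does not leave the ring. Moreover, bounds on
-- single digits are not enough. For -τ, the digits 0 and 1 keep the conjugate below Σ τ⁻ⁱ = τ², but
-- for τ² the digits 0, 1, 2 alone would allow values close to 2 Σ τ⁻²ⁱ = 2 τ > τ². Hence the bound
-- on the conjugate has to depend on the current point of the orbit. The threshold τ⁻¹ comes from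
-- the right endpoint 1 of the domain: τ² · 1 - 2 = τ⁻¹, which is then fixed, since τ² τ⁻¹ - 1 =
-- τ⁻¹. The same dependence removes the spurious remainders: τ⁻¹ has τ²-digits 111..., and -τ⁻¹ has
-- (-τ)-digits 1000..., so either would leave a nonzero digit just after the radix point.

module RealFieldProperties {c ℓ₁ ℓ₂ : Level} (ℝ : RealField c ℓ₁ ℓ₂) where

  open Expansions ℝ
  module CR = CommutativeRing commutativeRing
  open RingProperties CR.ring using (-‿distribˡ-*; -‿distribʳ-*; -‿involutive; -0#≈0#)
  open AbelianGroupProperties CR.+-abelianGroup using (⁻¹-∙-comm)
  open SemiringMult CR.semiring using (×-homo-+; ×1-homo-*)
  open SetoidReasoning CR.setoid

  -- The integers inside the reals

  fromℤ-neg : ∀ m → fromℤ (ℤ.- m) ≈ - fromℤ m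
  fromℤ-neg (+ zero)  = sym -0#≈0#
  fromℤ-neg (+ suc n) = CR.refl
  fromℤ-neg -[1+ n ]  = sym (-‿involutive _)

  fromℤ-⊖ : ∀ m n → fromℤ (m ℤ.⊖ n) ≈ m ×ₙ 1# - n ×ₙ 1#
  fromℤ-⊖ zero    zero    = sym (CR.-‿inverseʳ 0#)
  fromℤ-⊖ zero    (suc n) = sym (CR.+-identityˡ _)
  fromℤ-⊖ (suc m) zero    = sym (trans (CR.+-congˡ -0#≈0#) (CR.+-identityʳ _))
  fromℤ-⊖ (suc m) (suc n) = begin
    fromℤ (suc m ℤ.⊖ suc n)    ≡⟨ ≡.cong fromℤ (ℤ.[1+m]⊖[1+n]≡m⊖n m n) ⟩
    fromℤ (m ℤ.⊖ n)            ≈⟨ fromℤ-⊖ m n ⟩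
    a - b                      ≈⟨ CR.+-congʳ (y-x+x≈y a (- 1#)) ⟨
    ((a - - 1#) + - 1#) - b    ≈⟨ CR.+-assoc _ _ _ ⟩
    (a - - 1#) + (- 1# - b)    ≈⟨ CR.+-cong (CR.+-congˡ (-‿involutive 1#)) (⁻¹-∙-comm 1# b) ⟩
    (a + 1#) - (1# + b)        ≈⟨ CR.+-congʳ (CR.+-comm a 1#) ⟩
    (1# + a) - (1# + b)        ∎
    where
    a = m ×ₙ 1#
    b = n ×ₙ 1#

  fromℤ-+ : ∀ m n → fromℤ (m ℤ.+ n) ≈ fromℤ m + fromℤ n
  fromℤ-+ (+ m)    (+ n)    = ×-homo-+ 1# m n
  fromℤ-+ (+ m)    -[1+ n ] = fromℤ-⊖ m (suc n)
  fromℤ-+ -[1+ m ] (+ n)    = trans (fromℤ-⊖ n (suc m)) (CR.+-comm _ _)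
  fromℤ-+ -[1+ m ] -[1+ n ] = begin
    - (suc (suc (m ℕ.+ n)) ×ₙ 1#)      ≡⟨ ≡.cong (λ k → - (suc k ×ₙ 1#)) (ℕ.+-suc m n) ⟨
    - ((suc m ℕ.+ suc n) ×ₙ 1#)        ≈⟨ CR.-‿cong (×-homo-+ 1# (suc m) (suc n)) ⟩
    - (suc m ×ₙ 1# + suc n ×ₙ 1#)      ≈⟨ ⁻¹-∙-comm _ _ ⟨
    - (suc m ×ₙ 1#) - suc n ×ₙ 1#      ∎

  fromℤ-*⁺ : ∀ m n → fromℤ (+ m ℤ.* n) ≈ fromℤ (+ m) * fromℤ n
  fromℤ-*⁺ m (+ n) = begin
    fromℤ (+ m ℤ.* + n)     ≡⟨ ≡.cong fromℤ (ℤ.pos-* m n) ⟨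
    (m ℕ.* n) ×ₙ 1#         ≈⟨ ×1-homo-* m n ⟩
    m ×ₙ 1# * n ×ₙ 1#       ∎
  fromℤ-*⁺ m -[1+ n ] = begin
    fromℤ (+ m ℤ.* -[1+ n ])          ≡⟨ ≡.cong fromℤ (ℤ.neg-distribʳ-* (+ m) (+ suc n)) ⟨
    fromℤ (ℤ.- (+ m ℤ.* + suc n))     ≈⟨ fromℤ-neg (+ m ℤ.* + suc n) ⟩
    - fromℤ (+ m ℤ.* + suc n)         ≈⟨ CR.-‿cong (fromℤ-*⁺ m (+ suc n)) ⟩
    - (m ×ₙ 1# * suc n ×ₙ 1#)         ≈⟨ -‿distribʳ-* _ _ ⟩
    m ×ₙ 1# * - (suc n ×ₙ 1#)         ∎

  fromℤ-* : ∀ m n → fromℤ (m ℤ.* n) ≈ fromℤ m * fromℤ n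
  fromℤ-* (+ m)    n = fromℤ-*⁺ m n
  fromℤ-* -[1+ m ] n = begin
    fromℤ (-[1+ m ] ℤ.* n)          ≡⟨ ≡.cong fromℤ (ℤ.neg-distribˡ-* (+ suc m) n) ⟨
    fromℤ (ℤ.- (+ suc m ℤ.* n))     ≈⟨ fromℤ-neg (+ suc m ℤ.* n) ⟩
    - fromℤ (+ suc m ℤ.* n)         ≈⟨ CR.-‿cong (fromℤ-*⁺ (suc m) n) ⟩
    - (suc m ×ₙ 1# * fromℤ n)       ≈⟨ -‿distribˡ-* _ _ ⟩
    - (suc m ×ₙ 1#) * fromℤ n       ∎

  fromℤ-1 : fromℤ (+ 1) ≈ 1#
  fromℤ-1 = CR.+-identityʳ 1#

  private
    fromℤ-homomorphism : ℤ.+-*-rawRing -Raw-AlmostCommutative⟶ fromCommutativeRing commutativeRing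
    fromℤ-homomorphism = record
      { ⟦_⟧    = fromℤ
      ; +-homo = fromℤ-+
      ; *-homo = fromℤ-*
      ; -‿homo = fromℤ-neg
      ; 0-homo = CR.refl
      ; 1-homo = fromℤ-1
      }

    fromℤ-≟ : ∀ m n → Maybe (fromℤ m ≈ fromℤ n)
    fromℤ-≟ m n with m ℤ.≟ n
    ... | yes ≡.refl = just CR.refl
    ... | no  _      = nothing

  -- Coefficients are integers read through `fromℤ`, so constants are folded by integer arithmetic.
  -- The price is that `con 1ℤ` denotes `1# + 0#`, which equals `1#` only up to `_≈_`.
  module ℤ-Solver =
    RingSolver ℤ.+-*-rawRing (fromCommutativeRing commutativeRing) fromℤ-homomorphism fromℤ-≟
  open ℤ-Solver

  -- Order, inverses and absolute values

  ≤-refl : ∀ {x} → x ≤ x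
  ≤-refl = <.irrefl CR.refl

  <⇒≤ : ∀ {x y} → x < y → x ≤ y
  <⇒≤ = <.asym

  ≤-respˡ : ∀ {x y z} → x ≈ y → x ≤ z → y ≤ z
  ≤-respˡ x≈y x≤z z<y = x≤z (<-respʳ (sym x≈y) z<y)

  ≤-respʳ : ∀ {x y z} → x ≈ y → z ≤ x → z ≤ y
  ≤-respʳ x≈y z≤x y<z = z≤x (<-respˡ (sym x≈y) y<z)

  <-≤-trans : ∀ {x y z} → x < y → y ≤ z → x < z
  <-≤-trans x<y y≤z with <-cotrans x<y _
  ... | inj₁ x<z = x<z
  ... | inj₂ z<y = ⊥-elim (y≤z z<y)

  ≤-<-trans : ∀ {x y z} → x ≤ y → y < z → x < z
  ≤-<-trans x≤y y<z with <-cotrans y<z _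
  ... | inj₁ y<x = ⊥-elim (x≤y y<x)
  ... | inj₂ x<z = x<z

  ≤-trans : ∀ {x y z} → x ≤ y → y ≤ z → x ≤ z
  ≤-trans x≤y y≤z z<x = y≤z (<-≤-trans z<x x≤y)

  ≤-antisym : ∀ {x y} → x ≤ y → y ≤ x → x ≈ y
  ≤-antisym x≤y y≤x = proj₁ (tight _ _) λ x#y → [ y≤x , x≤y ]′ (#⇒<⊎> x#y)

  -- An inequality is proved by exhibiting a known one whose two sides have the
  -- same difference, which reduces it to a ring identity.
  <-shift : ∀ {w x y z} → w < x → x - w ≈ z - y → y < z
  <-shift w<x eq = 0<y-x⇒x<y (<-respʳ eq (x<y⇒0<y-x w<x))

  ≤-shift : ∀ {w x y z} → w ≤ x → x - w ≈ z - y → y ≤ z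
  ≤-shift {w} {x} {y} {z} w≤x eq z<y = w≤x (<-shift z<y (begin
    y - z     ≈⟨ solve 2 (λ y z → y :- z := :- (z :- y)) CR.refl y z ⟩
    - (z - y) ≈⟨ CR.-‿cong eq ⟨
    - (x - w) ≈⟨ solve 2 (λ x w → :- (x :- w) := w :- x) CR.refl x w ⟩
    w - x     ∎))

  +-monoʳ-< : ∀ z {x y} → x < y → z + x < z + y
  +-monoʳ-< z {x} {y} x<y =
    <-shift x<y (solve 3 (λ x y z → y :- x := (z :+ y) :- (z :+ x)) CR.refl x y z)

  +-monoˡ-≤ : ∀ z {x y} → x ≤ y → x + z ≤ y + z
  +-monoˡ-≤ z {x} {y} x≤y =
    ≤-shift x≤y (solve 3 (λ x y z → y :- x := (y :+ z) :- (x :+ z)) CR.refl x y z)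

  +-monoʳ-≤ : ∀ z {x y} → x ≤ y → z + x ≤ z + y
  +-monoʳ-≤ z {x} {y} x≤y =
    ≤-shift x≤y (solve 3 (λ x y z → y :- x := (z :+ y) :- (z :+ x)) CR.refl x y z)

  +-mono-< : ∀ {w x y z} → w < x → y < z → w + y < x + z
  +-mono-< w<x y<z = <.trans (+-monoˡ-< _ w<x) (+-monoʳ-< _ y<z)

  +-mono-<-≤ : ∀ {w x y z} → w < x → y ≤ z → w + y < x + z
  +-mono-<-≤ w<x y≤z = <-≤-trans (+-monoˡ-< _ w<x) (+-monoʳ-≤ _ y≤z)

  +-mono-≤ : ∀ {w x y z} → w ≤ x → y ≤ z → w + y ≤ x + z
  +-mono-≤ w≤x y≤z = ≤-trans (+-monoˡ-≤ _ w≤x) (+-monoʳ-≤ _ y≤z)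

  inv-inverseˡ : ∀ {x} (x#0 : x # 0#) → inv x x#0 * x ≈ 1#
  inv-inverseˡ {x} x#0 =
    trans (CR.*-congˡ (sym (HeytingProperties.x-0≈x heytingCommutativeRing x)))
          (proj₁ (proj₂ (#⇒invertible x#0)))

  inv-pos : ∀ {x} (0<x : 0# < x) → 0# < inv x (pos⇒#0 0<x)
  inv-pos {x} 0<x with #⇒<⊎> x⁻¹#0
    where
    open HeytingProperties heytingCommutativeRing using (invertibleʳ⇒#; x-0≈x)
    x⁻¹#0 : inv x (pos⇒#0 0<x) # 0#
    x⁻¹#0 = invertibleʳ⇒# (x , trans (CR.*-congʳ (x-0≈x _)) (inv-inverseˡ _))
  ... | inj₂ 0<x⁻¹ = 0<x⁻¹
  ... | inj₁ x⁻¹<0 = ⊥-elim (<.asym 0<1 (<-respˡ (trans (CR.*-comm _ _) (inv-inverseˡ _))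
                       (<-respʳ (CR.zeroʳ x) (*-monoʳ-< 0<x x⁻¹<0))))

  -- As `_≤_` is a negation, the product cannot be handled directly: a strict inequality the wrong
  -- way is multiplied by the positive inverse of `z` and contradicts `x ≤ y`.
  *-monoʳ-≤ : ∀ {x y z} → 0# < z → x ≤ y → z * x ≤ z * y
  *-monoʳ-≤ {x} {y} {z} 0<z x≤y zy<zx =
    x≤y (<-respˡ (cancel y) (<-respʳ (cancel x) (*-monoʳ-< (inv-pos 0<z) zy<zx)))
    where
    cancel : ∀ u → inv z (pos⇒#0 0<z) * (z * u) ≈ u
    cancel u = trans (sym (CR.*-assoc _ _ _))
                 (trans (CR.*-congʳ (inv-inverseˡ _)) (CR.*-identityˡ u))

  ∣x∣≈x : ∀ {x} → 0# ≤ x → ∣ x ∣ ≈ x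
  ∣x∣≈x {x} 0≤x with ⊔-supremum x (- x)
  ... | x≤∣x∣ , _ , least = ≤-antisym (least x ≤-refl -x≤x) x≤∣x∣
    where
    -x≤x : - x ≤ x
    -x≤x = ≤-shift (+-mono-≤ 0≤x 0≤x)
      (trans (CR.+-congˡ (CR.-‿cong (CR.+-identityʳ 0#)))
      (trans (CR.+-congˡ -0#≈0#) (trans (CR.+-identityʳ _) (CR.+-congˡ (sym (-‿involutive x))))))

  x≤∣x∣ : ∀ x → x ≤ ∣ x ∣
  x≤∣x∣ x = proj₁ (⊔-supremum x (- x))

  -x≤∣x∣ : ∀ x → - x ≤ ∣ x ∣
  -x≤∣x∣ x = proj₁ (proj₂ (⊔-supremum x (- x)))

  -- Limits of eventually constant sequences

  eventually-≈⇒⟶ : ∀ {s x} N → (∀ n → N ℕ.≤ n → s n ≈ x) → s ⟶ x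
  eventually-≈⇒⟶ {s} {x} N s≈x ε 0<ε = N , λ n N≤n → <-respˡ (sym (∣s-x∣≈0 n N≤n)) 0<ε
    where
    ∣s-x∣≈0 : ∀ n → N ℕ.≤ n → ∣ s n - x ∣ ≈ 0#
    ∣s-x∣≈0 n N≤n = trans (∣x∣≈x (≤-respʳ (sym s-x≈0) ≤-refl)) s-x≈0
      where
      s-x≈0 : s n - x ≈ 0#
      s-x≈0 = trans (CR.+-congʳ (s≈x n N≤n)) (CR.-‿inverseʳ x)

  -- Equality follows from refuting both strict orders: a gap between `x` and `y`, taken as ε, would
  -- persist in every late term.
  ⟶-eventually-≈ : ∀ {s x y} N → (∀ n → N ℕ.≤ n → s n ≈ y) → s ⟶ x → x ≈ y
  ⟶-eventually-≈ {s} {x} {y} N s≈y s⟶x = ≤-antisym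
    (λ y<x → far (x - y) (x<y⇒0<y-x y<x) λ n N≤n →
      ≤-respˡ (trans (CR.-‿cong (CR.+-congʳ (s≈y n N≤n)))
                     (solve 2 (λ x y → :- (y :- x) := x :- y) CR.refl x y))
              (-x≤∣x∣ (s n - x)))
    (λ x<y → far (y - x) (x<y⇒0<y-x x<y) λ n N≤n →
      ≤-respˡ (CR.+-congʳ (s≈y n N≤n)) (x≤∣x∣ (s n - x)))
    where
    far : ∀ ε → 0# < ε → (∀ n → N ℕ.≤ n → ε ≤ ∣ s n - x ∣) → ⊥
    far ε 0<ε ε≤ with s⟶x ε 0<ε
    ... | M , close = ε≤ (M ℕ.⊔ N) (ℕ.m≤n⊔m M N) (close (M ℕ.⊔ N) (ℕ.m≤m⊔n M N))

  -- Integers and floors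

  0≤n×1 : ∀ n → 0# ≤ n ×ₙ 1#
  0≤n×1 zero    = ≤-refl
  0≤n×1 (suc n) = ≤-trans (0≤n×1 n) (<⇒≤ (x<1+x _))

  fromℤ-mono-< : ∀ {m n} → m ℤ.< n → fromℤ m < fromℤ n
  fromℤ-mono-< {m} {n} m<n
    with n ℤ.- m in eq
       | ≡.subst (ℤ._< n ℤ.- m) (ℤ.+-inverseʳ m) (ℤ.+-monoˡ-< (ℤ.- m) m<n)
  ... | + suc k | _ = 0<y-x⇒x<y (<-respʳ n-m≈k (≤-<-trans (0≤n×1 k) (x<1+x _)))
    where
    n-m≈k : fromℤ (+ suc k) ≈ fromℤ n - fromℤ m
    n-m≈k = begin
      fromℤ (+ suc k)           ≡⟨ ≡.cong fromℤ eq ⟨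
      fromℤ (n ℤ.- m)           ≈⟨ fromℤ-+ n (ℤ.- m) ⟩
      fromℤ n + fromℤ (ℤ.- m)   ≈⟨ CR.+-congˡ (fromℤ-neg m) ⟩
      fromℤ n - fromℤ m         ∎
  ... | + zero  | +<+ ()

  fromℤ-mono-≤ : ∀ {m n} → m ℤ.≤ n → fromℤ m ≤ fromℤ n
  fromℤ-mono-≤ {m} {n} m≤n with m ℤ.≟ n
  ... | yes ≡.refl = ≤-refl
  ... | no  m≢n    = <⇒≤ (fromℤ-mono-< (ℤ.≤∧≢⇒< m≤n m≢n))

  *-fromℤ-cancel-< : ∀ {z} → 0# < z → ∀ {m n} → z * fromℤ m < z * fromℤ n → m ℤ.< n
  *-fromℤ-cancel-< 0<z {m} {n} zm<zn with m ℤ.<? n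
  ... | yes m<n = m<n
  ... | no  m≮n = ⊥-elim (*-monoʳ-≤ 0<z (fromℤ-mono-≤ (ℤ.≮⇒≥ m≮n)) zm<zn)

  fromℤ-cancel-< : ∀ {m n} → fromℤ m < fromℤ n → m ℤ.< n
  fromℤ-cancel-< m<n =
    *-fromℤ-cancel-< 0<1 (<-respˡ (sym (CR.*-identityˡ _)) (<-respʳ (sym (CR.*-identityˡ _)) m<n))

  floor≥ : ∀ {m n x} → fromℤ m ≤ x → IsFloor x n → m ℤ.≤ n
  floor≥ {m} {n} m≤x (_ , x<1+n) =
    ≡.subst (m ℤ.≤_) (ℤ.pred-suc n)
      (ℤ.i<j⇒i≤pred[j] (fromℤ-cancel-< {m} {ℤ.suc n} (≤-<-trans m≤x x<1+n)))

  floor< : ∀ {m n x} → x < fromℤ m → IsFloor x n → n ℤ.< m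
  floor< x<m (n≤x , _) = fromℤ-cancel-< (≤-<-trans n≤x x<m)

  -- A general real has no computable floor; comparability with every integer is what makes the
  -- descent from an Archimedean bound possible.
  floor-exists : ∀ {x} → (∀ n → x < fromℤ n ⊎ fromℤ n ≤ x) → 0# ≤ x → ∃[ n ] IsFloor x n
  floor-exists {x} compare 0≤x = search (proj₁ (archimedean x)) (proj₂ (archimedean x))
    where
    search : ∀ N → x < N ×ₙ 1# → ∃[ n ] IsFloor x n
    search zero    x<0   = ⊥-elim (0≤x x<0)
    search (suc N) x<1+N with compare (+ N)
    ... | inj₁ x<N = search N x<N
    ... | inj₂ N≤x = + N , N≤x , x<1+N

-- The ring ℤ[τ] and its conjugation

-- ⟨ a , b ⟩ stands for a + b τ.
record ℤ[τ] : Set where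
  constructor ⟨_,_⟩
  field
    rational golden : ℤ

infixl 6 _⊕_ _⊝_
infixl 7 _⊗_
infix  8 ⊖_

_⊕_ _⊗_ _⊝_ : ℤ[τ] → ℤ[τ] → ℤ[τ]
⟨ a , b ⟩ ⊕ ⟨ c , d ⟩ = ⟨ a ℤ.+ c , b ℤ.+ d ⟩
⟨ a , b ⟩ ⊗ ⟨ c , d ⟩ = ⟨ a ℤ.* c ℤ.+ b ℤ.* d , a ℤ.* d ℤ.+ b ℤ.* c ℤ.+ b ℤ.* d ⟩

⊖_ conj : ℤ[τ] → ℤ[τ]
⊖ ⟨ a , b ⟩ = ⟨ ℤ.- a , ℤ.- b ⟩
conj ⟨ a , b ⟩ = ⟨ a ℤ.+ b , ℤ.- b ⟩

p ⊝ q = p ⊕ ⊖ q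

ι : ℤ → ℤ[τ]
ι n = ⟨ n , 0ℤ ⟩

𝟘 𝟙 𝛕 𝛕² 𝛕⁻¹ 𝛕⁻² : ℤ[τ]
𝟘   = ι 0ℤ
𝟙   = ι 1ℤ
𝛕   = ⟨ 0ℤ , 1ℤ ⟩
𝛕²  = ⟨ 1ℤ , 1ℤ ⟩
𝛕⁻¹ = ⟨ -1ℤ , 1ℤ ⟩
𝛕⁻² = ⟨ + 2 , -1ℤ ⟩

ℤ[τ]-rawRing : RawRing _ _
ℤ[τ]-rawRing = record
  { Carrier = ℤ[τ] ; _≈_ = _≡_ ; _+_ = _⊕_ ; _*_ = _⊗_ ; -_ = ⊖_ ; 0# = 𝟘 ; 1# = 𝟙 }

conj-⊕ : ∀ p q → conj (p ⊕ q) ≡ conj p ⊕ conj q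
conj-⊕ ⟨ a , b ⟩ ⟨ c , d ⟩ = ≡.cong₂ ⟨_,_⟩ (rat a b c d) (ℤ.neg-distrib-+ b d)
  where
  rat : ∀ a b c d → a ℤ.+ c ℤ.+ (b ℤ.+ d) ≡ a ℤ.+ b ℤ.+ (c ℤ.+ d)
  rat = ℤ-RingSolver.solve-∀

conj-⊖ : ∀ p → conj (⊖ p) ≡ ⊖ conj p
conj-⊖ ⟨ a , b ⟩ = ≡.cong₂ ⟨_,_⟩ (≡.sym (ℤ.neg-distrib-+ a b)) ≡.refl

conj-⊗ : ∀ p q → conj (p ⊗ q) ≡ conj p ⊗ conj q
conj-⊗ ⟨ a , b ⟩ ⟨ c , d ⟩ = ≡.cong₂ ⟨_,_⟩ (rat a b c d) (gold a b c d)
  where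
  rat : ∀ a b c d → a ℤ.* c ℤ.+ b ℤ.* d ℤ.+ (a ℤ.* d ℤ.+ b ℤ.* c ℤ.+ b ℤ.* d) ≡
                    (a ℤ.+ b) ℤ.* (c ℤ.+ d) ℤ.+ ℤ.- b ℤ.* ℤ.- d
  rat = ℤ-RingSolver.solve-∀

  gold : ∀ a b c d → ℤ.- (a ℤ.* d ℤ.+ b ℤ.* c ℤ.+ b ℤ.* d) ≡
                     (a ℤ.+ b) ℤ.* ℤ.- d ℤ.+ ℤ.- b ℤ.* (c ℤ.+ d) ℤ.+ ℤ.- b ℤ.* ℤ.- d
  gold = ℤ-RingSolver.solve-∀

conj-ι : ∀ n → conj (ι n) ≡ ι n
conj-ι n = ≡.cong ι (ℤ.+-identityʳ n)

-- The golden ratio and the two real embeddings of ℤ[τ]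

module GoldenSection {c ℓ₁ ℓ₂ : Level} (ℝ : RealField c ℓ₁ ℓ₂) (√5 : RealField.Carrier ℝ)
  (√5-root : Expansions.IsSquareRoot ℝ (Expansions.fromℤ ℝ (+ 5)) √5) where

  open Expansions ℝ
  open RealFieldProperties ℝ
  open RingProperties CR.ring using (-0#≈0#)
  open SetoidReasoning CR.setoid

  τ : Carrier
  τ = goldenRatio √5

  τ*τ≈τ+1 : τ * τ ≈ τ + 1#
  τ*τ≈τ+1 = begin
    τ * τ                                         ≈⟨ CR.*-cong τ≈ τ≈ ⟩
    (½ * (𝕀 + √5)) * (½ * (𝕀 + √5))               ≈⟨ expand ⟩
    ½ * ½ * (𝕀 + (𝕀 + 𝕀) * √5 + √5 * √5)          ≈⟨ CR.*-congˡ (CR.+-congˡ (proj₂ √5-root)) ⟩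
    ½ * ½ * (𝕀 + (𝕀 + 𝕀) * √5 + fromℤ (+ 5))      ≈⟨ factor ⟩
    ½ * (𝕀 + 𝕀) * (½ * (𝕀 + √5) + ½ * (𝕀 + 𝕀))    ≈⟨ CR.*-cong ½*2 (CR.+-cong (sym τ≈) ½*2) ⟩
    1# * (τ + 1#)                                 ≈⟨ CR.*-identityˡ _ ⟩
    τ + 1#                                        ∎
    where
    open ℤ-Solver

    𝕀 : Carrier
    𝕀 = fromℤ 1ℤ

    τ≈ : τ ≈ ½ * (𝕀 + √5)
    τ≈ = CR.*-congˡ (CR.+-congʳ (sym fromℤ-1))

    ½*2 : ½ * (𝕀 + 𝕀) ≈ 1#
    ½*2 = trans (CR.*-congˡ (CR.+-cong fromℤ-1 fromℤ-1)) ½*2≈1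

    expand = solve 2 (λ h s → (h :* (con 1ℤ :+ s)) :* (h :* (con 1ℤ :+ s)) :=
      h :* h :* (con 1ℤ :+ (con 1ℤ :+ con 1ℤ) :* s :+ s :* s)) CR.refl ½ √5

    factor = solve 2 (λ h s → h :* h :* (con 1ℤ :+ (con 1ℤ :+ con 1ℤ) :* s :+ con (+ 5)) :=
      h :* (con 1ℤ :+ con 1ℤ) :* (h :* (con 1ℤ :+ s) :+ h :* (con 1ℤ :+ con 1ℤ))) CR.refl ½ √5

  1<τ : 1# < τ
  1<τ = 1<goldenRatio √5-root

  -- Bounds are stated with φ 𝟘 and φ 𝟙 instead of 0# and 1# when they feed the
  -- solver over ℤ[τ], whose constants are read through φ.
  φ ψ : ℤ[τ] → Carrier
  φ ⟨ a , b ⟩ = fromℤ a + fromℤ b * τ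
  ψ p = φ (conj p)

  φ-⊕ : ∀ p q → φ (p ⊕ q) ≈ φ p + φ q
  φ-⊕ ⟨ a , b ⟩ ⟨ c , d ⟩ = trans
    (CR.+-cong (fromℤ-+ a c) (CR.*-congʳ (fromℤ-+ b d)))
    (solve 5 (λ a b c d t → (a :+ c) :+ (b :+ d) :* t := (a :+ b :* t) :+ (c :+ d :* t)) CR.refl
      (fromℤ a) (fromℤ b) (fromℤ c) (fromℤ d) τ)
    where open ℤ-Solver

  φ-⊖ : ∀ p → φ (⊖ p) ≈ - φ p
  φ-⊖ ⟨ a , b ⟩ = trans
    (CR.+-cong (fromℤ-neg a) (CR.*-congʳ (fromℤ-neg b)))
    (solve 3 (λ a b t → :- a :+ (:- b) :* t := :- (a :+ b :* t)) CR.refl (fromℤ a) (fromℤ b) τ)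
    where open ℤ-Solver

  φ-ι : ∀ n → φ (ι n) ≈ fromℤ n
  φ-ι n = trans (CR.+-congˡ (CR.zeroˡ τ)) (CR.+-identityʳ _)

  φ-𝟙 : φ 𝟙 ≈ 1#
  φ-𝟙 = trans (φ-ι 1ℤ) fromℤ-1

  φ-𝛕 : φ 𝛕 ≈ τ
  φ-𝛕 = trans (CR.+-identityˡ _) (trans (CR.*-congʳ fromℤ-1) (CR.*-identityˡ τ))

  φ-⊗ : ∀ p q → φ (p ⊗ q) ≈ φ p * φ q
  φ-⊗ ⟨ a , b ⟩ ⟨ c , d ⟩ = begin
    fromℤ (a ℤ.* c ℤ.+ b ℤ.* d) + fromℤ (a ℤ.* d ℤ.+ b ℤ.* c ℤ.+ b ℤ.* d) * τ
      ≈⟨ CR.+-cong (trans (fromℤ-+ (a ℤ.* c) (b ℤ.* d)) (CR.+-cong (fromℤ-* a c) (fromℤ-* b d)))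
           (CR.*-congʳ (trans (fromℤ-+ (a ℤ.* d ℤ.+ b ℤ.* c) (b ℤ.* d)) (CR.+-cong
             (trans (fromℤ-+ (a ℤ.* d) (b ℤ.* c)) (CR.+-cong (fromℤ-* a d) (fromℤ-* b c)))
             (fromℤ-* b d)))) ⟩
    (A * C + B * D) + (A * D + B * C + B * D) * τ
      ≈⟨ solve 5 (λ a b c d t → (a :* c :+ b :* d) :+ (a :* d :+ b :* c :+ b :* d) :* t :=
           a :* c :+ (a :* d :+ b :* c) :* t :+ b :* d :* (t :+ con 1ℤ)) CR.refl A B C D τ ⟩
    A * C + (A * D + B * C) * τ + B * D * (τ + fromℤ 1ℤ)
      ≈⟨ CR.+-congˡ (CR.*-congˡ (trans (CR.+-congˡ fromℤ-1) (sym τ*τ≈τ+1))) ⟩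
    A * C + (A * D + B * C) * τ + B * D * (τ * τ)
      ≈⟨ solve 5 (λ a b c d t → a :* c :+ (a :* d :+ b :* c) :* t :+ b :* d :* (t :* t) :=
           (a :+ b :* t) :* (c :+ d :* t)) CR.refl A B C D τ ⟩
    (A + B * τ) * (C + D * τ) ∎
    where
    open ℤ-Solver
    A = fromℤ a
    B = fromℤ b
    C = fromℤ c
    D = fromℤ d

  φ-⊝ : ∀ p q → φ (p ⊝ q) ≈ φ p - φ q
  φ-⊝ p q = trans (φ-⊕ p (⊖ q)) (CR.+-congˡ (φ-⊖ q))

  ψ-⊕ : ∀ p q → ψ (p ⊕ q) ≈ ψ p + ψ q
  ψ-⊕ p q = trans (reflexive (≡.cong φ (conj-⊕ p q))) (φ-⊕ (conj p) (conj q))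

  ψ-⊗ : ∀ p q → ψ (p ⊗ q) ≈ ψ p * ψ q
  ψ-⊗ p q = trans (reflexive (≡.cong φ (conj-⊗ p q))) (φ-⊗ (conj p) (conj q))

  ψ-⊝ : ∀ p q → ψ (p ⊝ q) ≈ ψ p - ψ q
  ψ-⊝ p q = trans (ψ-⊕ p (⊖ q))
    (CR.+-congˡ (trans (reflexive (≡.cong φ (conj-⊖ q))) (φ-⊖ (conj q))))

  private
    φ-homomorphism : ℤ[τ]-rawRing -Raw-AlmostCommutative⟶ fromCommutativeRing commutativeRing
    φ-homomorphism = record
      { ⟦_⟧    = φ
      ; +-homo = φ-⊕
      ; *-homo = φ-⊗
      ; -‿homo = φ-⊖
      ; 0-homo = φ-ι 0ℤ
      ; 1-homo = φ-𝟙
      }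

    φ-≟ : ∀ p q → Maybe (φ p ≈ φ q)
    φ-≟ ⟨ a , b ⟩ ⟨ c , d ⟩ with a ℤ.≟ c | b ℤ.≟ d
    ... | yes ≡.refl | yes ≡.refl = just CR.refl
    ... | _          | _          = nothing

  -- With coefficients in ℤ[τ] the relation τ² = τ + 1 is built into their multiplication, so
  -- identities between powers of τ hold by computing with pairs of integers.
  module ℤ[τ]-Solver =
    RingSolver ℤ[τ]-rawRing (fromCommutativeRing commutativeRing) φ-homomorphism φ-≟
  open ℤ[τ]-Solver

  0<τ : 0# < τ
  0<τ = 1<β⇒0<β 1<τ

  0<τ⁻¹ : 0# < φ 𝛕⁻¹
  0<τ⁻¹ = <-respˡ (φ-ι 0ℤ) (<-shift (<-respˡ (sym φ-𝟙) (<-respʳ (sym φ-𝛕) 1<τ))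
    (solve 0 (con 𝛕 :- con 𝟙 := con 𝛕⁻¹ :- con 𝟘) CR.refl))

  -- Decidable order on ℤ[τ]

  data Sign (x : Carrier) : Set (ℓ₁ ⊔ˡ ℓ₂) where
    negative : x < 0# → Sign x
    null     : x ≈ 0# → Sign x
    positive : 0# < x → Sign x

  sign-resp : ∀ {x y} → x ≈ y → Sign x → Sign y
  sign-resp x≈y (negative x<0) = negative (<-respˡ x≈y x<0)
  sign-resp x≈y (null x≈0)     = null (trans (sym x≈y) x≈0)
  sign-resp x≈y (positive 0<x) = positive (<-respʳ x≈y 0<x)

  sign-neg : ∀ {x} → Sign x → Sign (- x)
  sign-neg (negative x<0) = positive (x<0⇒0<-x x<0)
  sign-neg (null x≈0)     = null (trans (CR.-‿cong x≈0) -0#≈0#)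
  sign-neg (positive 0<x) = negative (0<x⇒-x<0 0<x)

  sign-* : ∀ {x y} → 0# < x → Sign y → Sign (x * y)
  sign-* 0<x (negative y<0) = negative (<-respʳ (CR.zeroʳ _) (*-monoʳ-< 0<x y<0))
  sign-* 0<x (null y≈0)     = null (trans (CR.*-congˡ y≈0) (CR.zeroʳ _))
  sign-* 0<x (positive 0<y) = positive (*-pos 0<x 0<y)

  -- Subtractive Euclid: (b + d) − b τ = − τ⁻¹ (b − d τ).
  sign-difference : ∀ a b → Acc ℕ._<_ (a ℕ.+ b) → Sign (φ ⟨ + a , ℤ.- + b ⟩)
  sign-difference zero    zero    _ = null (φ-ι 0ℤ)
  sign-difference (suc a) zero    _ =
    positive (<-respʳ (sym (φ-ι (+ suc a))) (fromℤ-mono-< {0ℤ} {+ suc a} (+<+ z<s)))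
  sign-difference a (suc b) (acc rec) with a ℕ.≤? suc b
  ... | yes a≤b = negative
    (<-respˡ (sym eq) (≤-<-trans (+-monoˡ-≤ _ (fromℤ-mono-≤ {+ a} {+ suc b} (+≤+ a≤b))) lt))
    where
    B = fromℤ (+ suc b)

    eq : φ ⟨ + a , -[1+ b ] ⟩ ≈ fromℤ (+ a) + - (B * τ)
    eq = CR.+-congˡ (solve 2 (λ b t → (:- b) :* t := :- (b :* t)) CR.refl B τ)

    lt : B - B * τ < 0#
    lt = <-shift (*-monoʳ-< (fromℤ-mono-< {0ℤ} {+ suc b} (+<+ z<s)) 1<τ)
      (trans (solve 3 (λ b t o → b :* t :- b :* o := con 𝟘 :- (b :* o :- b :* t)) CR.refl B τ 1#)
        (CR.+-cong (φ-ι 0ℤ) (CR.-‿cong (CR.+-congʳ (CR.*-identityʳ B)))))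
  ... | no  a≰b = sign-resp eq (sign-neg (sign-* 0<τ⁻¹ (sign-difference (suc b) d (rec smaller))))
    where
    d = a ℕ.∸ suc b
    b+d≡a : suc b ℕ.+ d ≡ a
    b+d≡a = ℕ.m+[n∸m]≡n (ℕ.<⇒≤ (ℕ.≰⇒> a≰b))

    smaller : suc b ℕ.+ d ℕ.< a ℕ.+ suc b
    smaller = ≡.subst (ℕ._< a ℕ.+ suc b) (≡.sym b+d≡a) (ℕ.m<m+n a z<s)

    eq : - (φ 𝛕⁻¹ * φ ⟨ + suc b , ℤ.- + d ⟩) ≈ φ ⟨ + a , -[1+ b ] ⟩
    eq = begin
      - (φ 𝛕⁻¹ * φ ⟨ + suc b , ℤ.- + d ⟩)
        ≈⟨ CR.-‿cong (CR.*-congˡ (CR.+-congˡ (CR.*-cong (fromℤ-neg (+ d)) (sym φ-𝛕)))) ⟩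
      - (φ 𝛕⁻¹ * (fromℤ (+ suc b) + - fromℤ (+ d) * φ 𝛕))
        ≈⟨ solve 2 (λ b d → :- (con 𝛕⁻¹ :* (b :+ (:- d) :* con 𝛕)) := (b :+ d) :+ (:- b) :* con 𝛕)
             CR.refl (fromℤ (+ suc b)) (fromℤ (+ d)) ⟩
      (fromℤ (+ suc b) + fromℤ (+ d)) + - fromℤ (+ suc b) * φ 𝛕
        ≈⟨ CR.+-cong (trans (sym (fromℤ-+ (+ suc b) (+ d)))
                       (reflexive (≡.cong (λ n → fromℤ (+ n)) b+d≡a)))
             (CR.*-congˡ φ-𝛕) ⟩
      φ ⟨ + a , -[1+ b ] ⟩ ∎

  sign-sum : ∀ a b → Sign (φ ⟨ + a , + b ⟩)
  sign-sum zero    zero    = null (φ-ι 0ℤ)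
  sign-sum zero    (suc b) =
    positive (<-respʳ (sym (CR.+-identityˡ _)) (*-pos (fromℤ-mono-< {0ℤ} {+ suc b} (+<+ z<s)) 0<τ))
  sign-sum (suc a) b       =
    positive (<-respˡ (CR.+-identityˡ 0#) (+-mono-<-≤ (fromℤ-mono-< {0ℤ} {+ suc a} (+<+ z<s)) 0≤bτ))
    where
    0≤bτ : 0# ≤ fromℤ (+ b) * τ
    0≤bτ = ≤-respˡ (CR.zeroʳ τ) (≤-respʳ (CR.*-comm τ (fromℤ (+ b))) (*-monoʳ-≤ 0<τ (0≤n×1 b)))

  -- Up to a global sign, the coordinates either agree in sign, where the answer is immediate, or
  -- differ, where the Euclidean descent decides. This trichotomy makes the floors along an orbit in
  -- ℤ[τ] computable.
  sign : ∀ p → Sign (φ p)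
  sign ⟨ + a      , + b      ⟩ = sign-sum a b
  sign ⟨ + a      , -[1+ b ] ⟩ = sign-difference a (suc b) (<-wellFounded _)
  sign ⟨ -[1+ a ] , + b      ⟩ = sign-resp
    (trans (sym (φ-⊖ ⟨ + suc a , ℤ.- + b ⟩))
      (reflexive (≡.cong (λ n → φ ⟨ -[1+ a ] , n ⟩) (ℤ.neg-involutive (+ b)))))
    (sign-neg (sign-difference (suc a) b (<-wellFounded _)))
  sign ⟨ -[1+ a ] , -[1+ b ] ⟩ =
    sign-resp (sym (φ-⊖ ⟨ + suc a , + suc b ⟩)) (sign-neg (sign-sum (suc a) (suc b)))

  infix 4 _<?_

  _<?_ : ∀ p q → Dec (φ p < φ q)
  p <? q with sign (q ⊝ p)
  ... | positive 0<q-p = yes (0<y-x⇒x<y (<-respʳ (φ-⊝ q p) 0<q-p))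
  ... | null q-p≈0     = no λ p<q → <.irrefl (sym (trans (sym (φ-⊝ q p)) q-p≈0)) (x<y⇒0<y-x p<q)
  ... | negative q-p<0 = no λ p<q → <.asym (<-respˡ (φ-⊝ q p) q-p<0) (x<y⇒0<y-x p<q)

  φι-cancel-< : ∀ {m n} → φ (ι m) < φ (ι n) → m ℤ.< n
  φι-cancel-< {m} {n} m<n = fromℤ-cancel-< {m} {n} (<-respˡ (φ-ι m) (<-respʳ (φ-ι n) m<n))

  -- For closed `p` and `q` the implicit argument is found by evaluation: the constructor returned
  -- by `sign` depends only on the integer coordinates, never on the abstract reals.
  <φ : ∀ p q {_ : True (p <? q)} → φ p < φ q
  <φ p q {p<q} = toWitness p<q

  -- Points of ℤ[τ] in a strip

  -- φ v − ψ v = (2 τ − 1) b for v = a + b τ, so the strip leaves b = −1, 0, 1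
  -- and at most two values of a for each of them.
  strip-elements : ∀ v → φ (⊖ 𝛕⁻¹) ≤ φ v → φ v < φ 𝟙 → φ (⊖ 𝛕²) < ψ v → ψ v < φ 𝛕² →
            v ≡ 𝟘 ⊎ v ≡ 𝛕⁻¹ ⊎ v ≡ ⊖ 𝛕⁻¹
  strip-elements v@(⟨ a , b ⟩) l≤φ φ<1 -τ²<ψ ψ<τ² = cases b -2<b b<2 l-bτ≤a a<1-bτ -τ²<ψ ψ<τ²
    where
    A = fromℤ a
    B = fromℤ b

    φv≈ : φ v ≈ A + B * φ 𝛕
    φv≈ = CR.+-congˡ (CR.*-congˡ (sym φ-𝛕))

    ψv≈ : ψ v ≈ (A + B) + (- B) * φ 𝛕
    ψv≈ = CR.+-cong (fromℤ-+ a b) (CR.*-cong (fromℤ-neg b) (sym φ-𝛕))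

    √5≈ : ∀ n → φ ⟨ -1ℤ , + 2 ⟩ * φ (ι n) ≈ φ ⟨ -1ℤ , + 2 ⟩ * fromℤ n
    √5≈ n = CR.*-congˡ (φ-ι n)

    -- The bounds on both embeddings give (2 τ - 1) b < 1 + τ² = 2 + τ, which is below 2 (2 τ - 1).
    b<2 : b ℤ.< + 2
    b<2 = *-fromℤ-cancel-< {φ ⟨ -1ℤ , + 2 ⟩} (<-respˡ (φ-ι 0ℤ) (<φ 𝟘 ⟨ -1ℤ , + 2 ⟩))
      (<-respʳ (trans (φ-⊗ ⟨ -1ℤ , + 2 ⟩ (ι (+ 2))) (√5≈ (+ 2)))
        (<.trans
          (<-shift (+-mono-< (<-respˡ φv≈ φ<1) (<-respʳ ψv≈ -τ²<ψ))
            (solve 2 (λ a b →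
              (con 𝟙 :+ ((a :+ b) :+ (:- b) :* con 𝛕)) :- ((a :+ b :* con 𝛕) :+ con (⊖ 𝛕²)) :=
              con ⟨ + 2 , + 1 ⟩ :- con ⟨ -1ℤ , + 2 ⟩ :* b) CR.refl A B))
          (<φ ⟨ + 2 , + 1 ⟩ (⟨ -1ℤ , + 2 ⟩ ⊗ ι (+ 2)))))

    -2<b : -[1+ 1 ] ℤ.< b
    -2<b = *-fromℤ-cancel-< {φ ⟨ -1ℤ , + 2 ⟩} (<-respˡ (φ-ι 0ℤ) (<φ 𝟘 ⟨ -1ℤ , + 2 ⟩))
      (<-respˡ (trans (φ-⊗ ⟨ -1ℤ , + 2 ⟩ (ι -[1+ 1 ])) (√5≈ -[1+ 1 ]))
        (<.trans
          (<φ (⟨ -1ℤ , + 2 ⟩ ⊗ ι -[1+ 1 ]) (⊖ 𝛕⁻¹ ⊝ 𝛕²))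
          (<-shift (+-mono-<-≤ (<-respˡ ψv≈ ψ<τ²) (≤-respʳ φv≈ l≤φ))
            (solve 2 (λ a b →
              (con 𝛕² :+ (a :+ b :* con 𝛕)) :- (((a :+ b) :+ (:- b) :* con 𝛕) :+ con (⊖ 𝛕⁻¹)) :=
              con ⟨ -1ℤ , + 2 ⟩ :* b :- con (⊖ 𝛕⁻¹ ⊝ 𝛕²)) CR.refl A B))))

    bτ≈ : φ ⟨ 0ℤ , b ⟩ ≈ B * φ 𝛕
    bτ≈ = trans (CR.+-identityˡ _) (CR.*-congˡ (sym φ-𝛕))

    l-bτ≤a : φ (⊖ 𝛕⁻¹ ⊝ ⟨ 0ℤ , b ⟩) ≤ φ (ι a)
    l-bτ≤a = ≤-respˡ
      (sym (trans (φ-⊝ (⊖ 𝛕⁻¹) ⟨ 0ℤ , b ⟩) (CR.+-congˡ (CR.-‿cong bτ≈))))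
      (≤-respʳ (sym (φ-ι a)) (≤-shift (≤-respʳ φv≈ l≤φ)
        (solve 2 (λ a b → (a :+ b :* con 𝛕) :- con (⊖ 𝛕⁻¹) := a :- (con (⊖ 𝛕⁻¹) :- b :* con 𝛕))
          CR.refl A B)))

    a<1-bτ : φ (ι a) < φ (𝟙 ⊝ ⟨ 0ℤ , b ⟩)
    a<1-bτ = <-respʳ
      (sym (trans (φ-⊝ 𝟙 ⟨ 0ℤ , b ⟩) (CR.+-congˡ (CR.-‿cong bτ≈))))
      (<-respˡ (sym (φ-ι a)) (<-shift (<-respˡ φv≈ φ<1)
        (solve 2 (λ a b → con 𝟙 :- (a :+ b :* con 𝛕) := (con 𝟙 :- b :* con 𝛕) :- a) CR.refl A B)))

    cases : ∀ {a} b → -[1+ 1 ] ℤ.< b → b ℤ.< + 2 →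
            φ (⊖ 𝛕⁻¹ ⊝ ⟨ 0ℤ , b ⟩) ≤ φ (ι a) → φ (ι a) < φ (𝟙 ⊝ ⟨ 0ℤ , b ⟩) →
            φ (⊖ 𝛕²) < ψ ⟨ a , b ⟩ → ψ ⟨ a , b ⟩ < φ 𝛕² →
            ⟨ a , b ⟩ ≡ 𝟘 ⊎ ⟨ a , b ⟩ ≡ 𝛕⁻¹ ⊎ ⟨ a , b ⟩ ≡ ⊖ 𝛕⁻¹
    cases {a} (+ 0) _ _ lo hi _ _ = zero-case a
      (φι-cancel-< { -1ℤ} {a} (<-≤-trans (<φ (ι -1ℤ) (⊖ 𝛕⁻¹)) lo))
      (φι-cancel-< {a} {1ℤ} hi)
      where
      zero-case : ∀ a → -1ℤ ℤ.< a → a ℤ.< 1ℤ →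
                  ⟨ a , 0ℤ ⟩ ≡ 𝟘 ⊎ ⟨ a , 0ℤ ⟩ ≡ 𝛕⁻¹ ⊎ ⟨ a , 0ℤ ⟩ ≡ ⊖ 𝛕⁻¹
      zero-case (+ 0)     _        _              = inj₁ ≡.refl
      zero-case (+ suc _) _        (+<+ (s<s ()))
      zero-case -[1+ _ ]  (-<- ()) _
    cases {a} (+ 1) _ _ lo hi -τ²<ψ _ = one-case a
      (φι-cancel-< { -[1+ 2 ]} {a} (<-≤-trans (<φ (ι -[1+ 2 ]) (⊖ 𝛕⁻¹ ⊝ 𝛕)) lo))
      (φι-cancel-< {a} {0ℤ} (<.trans hi (<φ (𝟙 ⊝ 𝛕) 𝟘))) -τ²<ψ
      where
      one-case : ∀ a → -[1+ 2 ] ℤ.< a → a ℤ.< 0ℤ → φ (⊖ 𝛕²) < ψ ⟨ a , 1ℤ ⟩ →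
                 ⟨ a , 1ℤ ⟩ ≡ 𝟘 ⊎ ⟨ a , 1ℤ ⟩ ≡ 𝛕⁻¹ ⊎ ⟨ a , 1ℤ ⟩ ≡ ⊖ 𝛕⁻¹
      one-case -[1+ 0 ]           _ _ _     = inj₂ (inj₁ ≡.refl)
      -- Here v = -τ⁻² lies in the strip for `φ`, but its conjugate is exactly -τ², so only
      -- strictness excludes it. The value τ⁻² with conjugate τ² is excluded in the same way for b =
      -- -1.
      one-case -[1+ 1 ]           _ _ -τ²<ψ = ⊥-elim (<.irrefl CR.refl -τ²<ψ)
      one-case -[1+ suc (suc _) ] (-<- (s<s (s<s ()))) _ _
      one-case (+ _)              _ (+<+ ()) _
    cases {a} -[1+ 0 ] _ _ lo hi _ ψ<τ² = minus-one-case a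
      (φι-cancel-< {0ℤ} {a} (<-≤-trans (<φ 𝟘 (⊖ 𝛕⁻¹ ⊕ 𝛕)) lo))
      (φι-cancel-< {a} {+ 3} (<.trans hi (<φ (𝟙 ⊕ 𝛕) (ι (+ 3))))) ψ<τ²
      where
      minus-one-case : ∀ a → 0ℤ ℤ.< a → a ℤ.< + 3 → ψ ⟨ a , -1ℤ ⟩ < φ 𝛕² →
                       ⟨ a , -1ℤ ⟩ ≡ 𝟘 ⊎ ⟨ a , -1ℤ ⟩ ≡ 𝛕⁻¹ ⊎ ⟨ a , -1ℤ ⟩ ≡ ⊖ 𝛕⁻¹
      minus-one-case (+ 0)                 (+<+ ()) _ _
      minus-one-case (+ 1)                 _ _ _    = inj₂ (inj₂ ≡.refl)
      minus-one-case (+ 2)                 _ _ ψ<τ² = ⊥-elim (<.irrefl CR.refl ψ<τ²)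
      minus-one-case (+ suc (suc (suc _))) _ (+<+ (s<s (s<s (s<s ())))) _
      minus-one-case -[1+ _ ]              () _ _
    cases (+ suc (suc _)) _ (+<+ (s<s (s<s ())))
    cases -[1+ suc _ ] (-<- (s<s ())) _

  -- Digit bounds, scaling and conjugate estimates

  compare : ∀ {x} q → x ≈ φ q → ∀ n → x < fromℤ n ⊎ fromℤ n ≤ x
  compare q x≈q n with q <? ι n
  ... | yes q<n = inj₁ (<-respˡ (sym x≈q) (<-respʳ (φ-ι n) q<n))
  ... | no  q≮n = inj₂ (≤-respˡ (φ-ι n) (≤-respʳ (sym x≈q) q≮n))

  floor-φ : ∀ {x y d} → x ≈ y → IsFloor x d → φ (ι d) ≤ y × y < φ (ι d) + φ 𝟙
  floor-φ {d = d} x≈y (d≤x , x<1+d) =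
    ≤-respˡ (sym (φ-ι d)) (≤-respʳ x≈y d≤x) ,
    <-respʳ (trans (fromℤ-+ 1ℤ d) (trans (CR.+-comm _ _) (CR.+-cong (sym (φ-ι d)) (sym (φ-ι 1ℤ)))))
      (<-respˡ x≈y x<1+d)

  digit-bounds : ∀ {x d m n} → IsFloor x d → φ (ι m) ≤ x → x < φ (ι n) → m ℤ.≤ d × d ℤ.< n
  digit-bounds {d = d} {m} {n} floor m≤x x<n =
    floor≥ {m} {d} (≤-respˡ (φ-ι m) m≤x) floor , floor< {m = n} (<-respʳ (φ-ι n) x<n) floor

  floor-of-fraction : ∀ {x d} → φ 𝟘 ≤ x → x < φ 𝟙 → IsFloor x d → d ≡ 0ℤ
  floor-of-fraction {x} {d} 0≤x x<1 floor = d≡0 (digit-bounds {x} {d} {0ℤ} {1ℤ} floor 0≤x x<1)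
    where
    d≡0 : ∀ {d} → 0ℤ ℤ.≤ d × d ℤ.< 1ℤ → d ≡ 0ℤ
    d≡0 {+ 0}     _                 = ≡.refl
    d≡0 {+ suc _} (_ , +<+ (s<s ()))

  0<τ⁻² : 0# < φ 𝛕⁻²
  0<τ⁻² = <-respˡ (φ-ι 0ℤ) (<φ 𝟘 𝛕⁻²)

  τ⁻²ⁿ-pos : ∀ n → 0# < φ 𝛕⁻² ^ n
  τ⁻²ⁿ-pos zero    = 0<1
  τ⁻²ⁿ-pos (suc n) = *-pos 0<τ⁻² (τ⁻²ⁿ-pos n)

  -- A Bernoulli-type estimate that turns the Archimedean bound into geometric decay. The induction
  -- rests on (n + 1) - τ⁻² (n + 2) = τ⁻¹ n + (τ⁻¹ - τ⁻²), where both summands are nonnegative.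
  τ⁻²ⁿ*[1+n]≤1 : ∀ n → φ 𝛕⁻² ^ n * (suc n ×ₙ 1#) ≤ 1#
  τ⁻²ⁿ*[1+n]≤1 zero    = ≤-respˡ (sym (trans (CR.*-identityˡ _) (CR.+-identityʳ 1#))) ≤-refl
  τ⁻²ⁿ*[1+n]≤1 (suc n) = ≤-respˡ
    (solve 3 (λ t tⁿ x → tⁿ :* (t :* x) := (t :* tⁿ) :* x) CR.refl
      (φ 𝛕⁻²) (φ 𝛕⁻² ^ n) (suc (suc n) ×ₙ 1#))
    (≤-trans (*-monoʳ-≤ (τ⁻²ⁿ-pos n) shorten) (τ⁻²ⁿ*[1+n]≤1 n))
    where
    shorten : φ 𝛕⁻² * (suc (suc n) ×ₙ 1#) ≤ suc n ×ₙ 1#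
    shorten = ≤-respˡ (CR.*-congˡ (CR.+-cong φ-𝟙 (CR.+-congʳ φ-𝟙))) (≤-respʳ (CR.+-congʳ φ-𝟙)
      (≤-shift (+-mono-≤ (<⇒≤ (<φ 𝛕⁻² 𝛕⁻¹)) (*-monoʳ-≤ 0<τ⁻¹ (0≤n×1 n)))
        (trans (CR.+-congˡ (CR.-‿cong (CR.+-congˡ (CR.*-congˡ (sym (φ-ι 0ℤ))))))
          (solve 1 (λ n → (con 𝛕⁻¹ :+ con 𝛕⁻¹ :* n) :- (con 𝛕⁻² :+ con 𝛕⁻¹ :* con 𝟘) :=
            (con 𝟙 :+ n) :- con 𝛕⁻² :* (con 𝟙 :+ (con 𝟙 :+ n))) CR.refl (n ×ₙ 1#)))))

  shrink-τ⁻² : ∀ x → 0# ≤ x → ∃[ n ] 0# ≤ φ 𝛕⁻² ^ suc n * x × φ 𝛕⁻² ^ suc n * x < φ 𝛕⁻²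
  shrink-τ⁻² x 0≤x with archimedean x
  ... | n , x<n = n ,
    ≤-respˡ (CR.zeroʳ _) (*-monoʳ-≤ (τ⁻²ⁿ-pos (suc n)) 0≤x) ,
    <-respˡ (sym (CR.*-assoc _ _ _)) (<-respʳ (CR.*-identityʳ _) (*-monoʳ-< 0<τ⁻²
      (<-≤-trans (*-monoʳ-< (τ⁻²ⁿ-pos n) (<.trans x<n (x<1+x _))) (τ⁻²ⁿ*[1+n]≤1 n))))

  conj-remainder : ∀ w h → φ 𝟘 ≤ ψ h → ψ h < φ 𝛕² → φ 𝟘 ≤ ψ w → ψ w < φ 𝛕² →
                   φ (⊖ 𝛕²) < ψ (w ⊝ h) × ψ (w ⊝ h) < φ 𝛕²
  conj-remainder w h 0≤h h<τ² 0≤w w<τ² =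
    <-respʳ (sym (ψ-⊝ w h)) (<-shift (+-mono-<-≤ h<τ² 0≤w)
      (solve 2 (λ w h → (con 𝛕² :+ w) :- (h :+ con 𝟘) := (w :- h) :- con (⊖ 𝛕²)) CR.refl (ψ w) (ψ h))) ,
    <-respˡ (sym (ψ-⊝ w h)) (<-shift (+-mono-<-≤ w<τ² 0≤h)
      (solve 2 (λ w h → (con 𝛕² :+ h) :- (w :+ con 𝟘) := con 𝛕² :- (w :- h)) CR.refl (ψ w) (ψ h)))

  affine-nonneg : ∀ p {z d} → 0# < φ p → φ 𝟘 ≤ z → 0ℤ ℤ.≤ d → φ 𝟘 ≤ φ p * z + φ (ι d)
  affine-nonneg p {z} {d} 0<p 0≤z 0≤d =
    ≤-shift (+-mono-≤ (*-monoʳ-≤ 0<p 0≤z)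
               (≤-respˡ (sym (φ-ι 0ℤ)) (≤-respʳ (sym (φ-ι d)) (fromℤ-mono-≤ 0≤d))))
      (solve 3 (λ p z d → (p :* z :+ d) :- (p :* con 𝟘 :+ con 𝟘) := (p :* z :+ d) :- con 𝟘) CR.refl
        (φ p) z (φ (ι d)))

  affine-< : ∀ p q {z} d → 0# < φ p → z < φ q → φ p * z + φ (ι d) < φ (p ⊗ q ⊕ ι d)
  affine-< p q d 0<p z<q =
    <-respʳ (trans (CR.+-congʳ (sym (φ-⊗ p q))) (sym (φ-⊕ (p ⊗ q) (ι d))))
      (+-monoˡ-< _ (*-monoʳ-< 0<p z<q))

-- Expansions in a base that is a unit of ℤ[τ]

module CutAndProject {c ℓ₁ ℓ₂ : Level} (ℝ : RealField c ℓ₁ ℓ₂) (√5 : RealField.Carrier ℝ)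
  (√5-root : Expansions.IsSquareRoot ℝ (Expansions.fromℤ ℝ (+ 5)) √5) where

  open Expansions ℝ
  open RealFieldProperties ℝ
  open RingProperties CR.ring using (-0#≈0#)
  open GoldenSection ℝ √5 √5-root
  open SetoidReasoning CR.setoid

  horner : ℤ[τ] → (ℕ → ℤ) → ℕ → ℤ[τ]
  horner B d zero    = 𝟘
  horner B d (suc i) = B ⊗ horner B d i ⊕ ι (d i)

  -- Conjugation is not a function on the reals, so a point of the window carries the element of
  -- ℤ[τ] that is to be conjugated.
  InWindow : Pred Carrier (ℓ₁ ⊔ˡ ℓ₂)
  InWindow x = Σ[ w ∈ ℤ[τ] ] x ≈ φ w × φ 𝟘 ≤ ψ w × ψ w < φ 𝛕²

  -- Admissible is an invariant of the pairs (Tⁱ y , (bⁱ y − Tⁱ y)′): the difference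
  -- is the number written by the first i digits, so it has a conjugate for real y too.
  record System (b : Carrier) (b#0 : b # 0#) (Domain : Pred Carrier ℓ₂)
                (Digit : Carrier → ℤ → Set ℓ₂) :
                Set (lsuc (c ⊔ˡ ℓ₁ ⊔ˡ ℓ₂)) where
    field
      B B⁻¹           : ℤ[τ]
      b≈φB            : b ≈ φ B
      B*B⁻¹≈1         : φ B * φ B⁻¹ ≈ 1#
      Admissible      : Carrier → Carrier → Set (ℓ₁ ⊔ˡ ℓ₂)
      admissible-resp : ∀ {t t′ z z′} → t ≈ t′ → z ≈ z′ → Admissible t z → Admissible t′ z′
      initial         : ∀ {y} → Domain y → Admissible y (φ 𝟘)
      step            : ∀ {t z d} → Admissible t z → Digit t d →
                        Admissible (φ B * t - φ (ι d)) (ψ B * z + φ (ι d))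
      window          : ∀ {t z} → Admissible t z → φ 𝟘 ≤ z × z < φ 𝛕²
      digit-exists    : ∀ u {z} → Admissible (φ u) z → ∃[ d ] Digit (φ u) d
      digit-of-0      : ∀ {t d} → t ≈ 0# → Digit t d → d ≡ 0ℤ
      remainder≈0     : ∀ w h → Admissible (φ (w ⊝ h)) (ψ h) → φ 𝟘 ≤ ψ w → ψ w < φ 𝛕² →
                        φ (w ⊝ h) ≈ 0#
      shrink          : ∀ x → 0# ≤ x → ∃[ K ] Domain (φ B⁻¹ ^ suc K * x)

  module _ {b b#0 Domain Digit} (S : System b b#0 Domain Digit) where
    open System S
    open Exp CR.commutativeSemiring using (^-congˡ; ^-distrib-*)

    IsDigits : Carrier → (ℕ → ℤ) → Set (c ⊔ˡ ℓ₁ ⊔ˡ ℓ₂)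
    IsDigits = IsDigitSequence b Digit

    term : ℤ → (ℕ → ℤ) → ℕ → Carrier
    term k d j = fromℤ (d j) * zpow b b#0 (k ℤ.- + j)

    φ-horner-suc : ∀ d i → φ (horner B d (suc i)) ≈ φ B * φ (horner B d i) + φ (ι (d i))
    φ-horner-suc d i = trans (φ-⊕ (B ⊗ horner B d i) (ι (d i)))
      (CR.+-congʳ (φ-⊗ B (horner B d i)))

    ψ-horner-suc : ∀ d i → ψ (horner B d (suc i)) ≈ ψ B * ψ (horner B d i) + φ (ι (d i))
    ψ-horner-suc d i = trans (ψ-⊕ (B ⊗ horner B d i) (ι (d i)))
      (CR.+-cong (ψ-⊗ B (horner B d i)) (reflexive (≡.cong φ (conj-ι (d i)))))

    digits-admissible : ∀ {y d} → Domain y → ((t , _) : IsDigits y d) →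
                        ∀ i → Admissible (t i) (ψ (horner B d i))
    digits-admissible y∈D (t , t0≈y , rec) zero =
      admissible-resp (sym t0≈y) CR.refl (initial y∈D)
    digits-admissible {d = d} y∈D e@(t , t0≈y , rec) (suc i) =
      admissible-resp
        (sym (trans (proj₂ (rec i)) (CR.+-cong (CR.*-congʳ b≈φB) (CR.-‿cong (sym (φ-ι (d i)))))))
        (sym (ψ-horner-suc d i))
        (step (digits-admissible y∈D e i) (proj₁ (rec i)))

    -- The first `n` digits occupy the positions from `K` down to `m`, so they form a Horner value
    -- shifted by `m` places. Passing `m` with `n + m = K + 1` keeps all exponents natural and makes
    -- the case `m = 0` the integer part.
    partialSum≈horner : ∀ K d m n → n ℕ.+ m ≡ suc K →
                        partialSum (term (+ K) d) n ≈ b ^ m * φ (horner B d n)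
    partialSum≈horner K d m zero    _     = sym (trans (CR.*-congˡ (φ-ι 0ℤ)) (CR.zeroʳ _))
    partialSum≈horner K d m (suc n) n+m≡K = begin
      partialSum (term (+ K) d) n + fromℤ (d n) * zpow b b#0 (+ K ℤ.- + n)
        ≈⟨ CR.+-cong (partialSum≈horner K d (suc m) n (≡.trans (ℕ.+-suc n m) n+m≡K))
             (CR.*-congˡ (reflexive (≡.cong (zpow b b#0) K-n≡m))) ⟩
      (b * b ^ m) * H + fromℤ (d n) * b ^ m
        ≈⟨ solve 4 (λ b bᵐ h d → (b :* bᵐ) :* h :+ d :* bᵐ := bᵐ :* (b :* h :+ d)) CR.refl
             b (b ^ m) H (fromℤ (d n)) ⟩
      b ^ m * (b * H + fromℤ (d n))
        ≈⟨ CR.*-congˡ (trans (CR.+-cong (CR.*-congʳ b≈φB) (sym (φ-ι (d n))))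
             (sym (φ-horner-suc d n))) ⟩
      b ^ m * φ (horner B d (suc n)) ∎
      where
      open ℤ-Solver
      H = φ (horner B d n)

      K-n≡m : + K ℤ.- + n ≡ + m
      K-n≡m = ≡.trans (ℤ.m-n≡m⊖n K n) (≡.trans
        (≡.cong (ℤ._⊖ n) (≡.sym (ℕ.suc-injective n+m≡K)))
        (≡.trans (ℤ.⊖-≥ (ℕ.m≤m+n n m)) (≡.cong +_ (ℕ.m+n∸m≡n n m))))

    partialSum-stable : ∀ k d N → (∀ j → N ℕ.≤ j → d j ≡ 0ℤ) →
                        ∀ n → N ℕ.≤ n → partialSum (term k d) n ≈ partialSum (term k d) N
    partialSum-stable k d N d≡0 n N≤n = ≡.subst (λ n → partialSum (term k d) n ≈ _)
      (ℕ.m+[n∸m]≡n N≤n) (stable (n ℕ.∸ N))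
      where
      stable : ∀ r → partialSum (term k d) (N ℕ.+ r) ≈ partialSum (term k d) N
      stable zero    = reflexive (≡.cong (partialSum (term k d)) (ℕ.+-identityʳ N))
      stable (suc r) rewrite ℕ.+-suc N r | d≡0 (N ℕ.+ r) (ℕ.m≤m+n N r) =
        trans (CR.+-cong (stable r) (CR.zeroˡ _)) (CR.+-identityʳ _)

    expansion-sum : ∀ K d → (∀ j → suc K ℕ.≤ j → d j ≡ 0ℤ) →
                    ∀ n → suc K ℕ.≤ n → partialSum (term (+ K) d) n ≈ φ (horner B d (suc K))
    expansion-sum K d d≡0 n K<n = trans (partialSum-stable (+ K) d (suc K) d≡0 n K<n)
      (trans (partialSum≈horner K d 0 (suc K) (ℕ.+-identityʳ _)) (CR.*-identityˡ _))

    integral⇒inWindow : ∀ {x} (e : Expansion b b#0 Domain IsDigits x) →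
                        Expansion.IsIntegral e → InWindow x
    integral⇒inWindow {x} e integral with Expansion.k e | Expansion.hasSum e | integral
    ... | + K | sum | d≡0 = horner B digit (suc K) ,
        ⟶-eventually-≈ (suc K) (expansion-sum K digit λ j K<j → d≡0 j (K-j<0 K<j)) sum ,
        window (digits-admissible y∈Domain isDigits (suc K))
      where
      open Expansion e using (digit; y∈Domain; isDigits)
      K-j<0 : ∀ {j} → K ℕ.< j → + K ℤ.- + j ℤ.< 0ℤ
      K-j<0 {j} K<j = ≡.subst (+ K ℤ.- + j ℤ.<_) (ℤ.+-inverseʳ (+ j))
        (ℤ.+-monoˡ-< (ℤ.- + j) (+<+ K<j))
    -- With a negative leading position every digit vanishes, so x is 0; the window bounds for `𝟘`
    -- are those of the initial admissible pair.
    ... | -[1+ K ] | sum | d≡0 = 𝟘 ,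
        ⟶-eventually-≈ 0 (λ n 0≤n → trans
          (partialSum-stable -[1+ K ] digit 0 (λ j _ → d≡0 j (-K-j<0 j)) n 0≤n) (sym (φ-ι 0ℤ))) sum ,
        window (initial y∈Domain)
      where
      open Expansion e using (digit; y∈Domain)
      -K-j<0 : ∀ j → -[1+ K ] ℤ.- + j ℤ.< 0ℤ
      -K-j<0 j = ℤ.≤-<-trans (ℤ.i≤j⇒i-k≤j (+ j) ℤ.≤-refl) -<+

    -- Choosing the next digit needs both an element of ℤ[τ], to decide the floor, and the
    -- invariant, to know the floor's argument is nonnegative; hence the orbit carries the two
    -- together.
    record State : Set (c ⊔ˡ ℓ₁ ⊔ˡ ℓ₂) where
      constructor state
      field
        {element} : ℤ[τ]
        {image}   : Carrier
        admissible : Admissible (φ element) image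

      next-digit : ∃[ d ] Digit (φ element) d
      next-digit = digit-exists element admissible

    open State

    φ-next : ∀ u d → φ (B ⊗ u ⊝ ι d) ≈ φ B * φ u - φ (ι d)
    φ-next u d = trans (φ-⊝ (B ⊗ u) (ι d)) (CR.+-congʳ (φ-⊗ B u))

    next : State → State
    next s = state {B ⊗ element s ⊝ ι (proj₁ (next-digit s))} (admissible-resp
      (sym (φ-next (element s) (proj₁ (next-digit s)))) CR.refl
      (step (admissible s) (proj₂ (next-digit s))))

    orbit : State → ℕ → State
    orbit s zero    = s
    orbit s (suc i) = next (orbit s i)

    φ-B⁻¹-multiple : ∀ n w → ∃[ u ] φ u ≈ φ B⁻¹ ^ n * φ w
    φ-B⁻¹-multiple zero    w = w , sym (CR.*-identityˡ _)
    φ-B⁻¹-multiple (suc n) w with φ-B⁻¹-multiple n w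
    ... | u , u≈ = B⁻¹ ⊗ u , trans (φ-⊗ B⁻¹ u) (trans (CR.*-congˡ u≈) (sym (CR.*-assoc _ _ _)))

    scaled : ∀ {y d} → ((t , _) : IsDigits y d) → ∀ i → φ B ^ i * y ≈ φ (horner B d i) + t i
    scaled {y} (t , t0≈y , rec) zero =
      trans (CR.*-identityˡ y) (trans (sym t0≈y)
        (sym (trans (CR.+-congʳ (φ-ι 0ℤ)) (CR.+-identityˡ _))))
    scaled {y} {d} e@(t , t0≈y , rec) (suc i) = begin
      (φ B * φ B ^ i) * y      ≈⟨ CR.*-assoc _ _ _ ⟩
      φ B * (φ B ^ i * y)      ≈⟨ CR.*-congˡ (scaled e i) ⟩
      φ B * (H + t i)          ≈⟨ solve 4 (λ b h t d → b :* (h :+ t) := (b :* h :+ d) :+ (b :* t :- d))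
                                    CR.refl (φ B) H (t i) (φ (ι (d i))) ⟩
      (φ B * H + φ (ι (d i))) + (φ B * t i - φ (ι (d i)))
        ≈⟨ CR.+-cong (φ-horner-suc d i) (trans (proj₂ (rec i))
             (CR.+-cong (CR.*-congʳ b≈φB) (CR.-‿cong (sym (φ-ι (d i)))))) ⟨
      φ (horner B d (suc i)) + t (suc i) ∎
      where
      open ℤ-Solver
      H = φ (horner B d i)

    digits-vanish : ∀ {y d} → ((t , _) : IsDigits y d) → ∀ N → t N ≈ 0# →
                    ∀ j → N ℕ.≤ j → d j ≡ 0ℤ
    digits-vanish {y} {d} (t , _ , rec) N tN≈0 j N≤j =
      ≡.subst (λ j → d j ≡ 0ℤ) (ℕ.m+[n∸m]≡n N≤j)
        (digit-of-0 (t≈0 (j ℕ.∸ N)) (proj₁ (rec (N ℕ.+ (j ℕ.∸ N)))))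
      where
      t≈0 : ∀ r → t (N ℕ.+ r) ≈ 0#
      t≈0 zero    = trans (reflexive (≡.cong t (ℕ.+-identityʳ N))) tN≈0
      t≈0 (suc r) rewrite ℕ.+-suc N r = begin
        t (suc (N ℕ.+ r))                          ≈⟨ proj₂ (rec (N ℕ.+ r)) ⟩
        b * t (N ℕ.+ r) - fromℤ (d (N ℕ.+ r))      ≈⟨ CR.+-cong (CR.*-congˡ (t≈0 r))
          (CR.-‿cong (reflexive (≡.cong fromℤ (digit-of-0 (t≈0 r) (proj₁ (rec (N ℕ.+ r))))))) ⟩
        b * 0# - 0#                                ≈⟨ CR.+-cong (CR.zeroʳ b) -0#≈0# ⟩
        0# + 0#                                    ≈⟨ CR.+-identityˡ 0# ⟩
        0#                                         ∎

    inWindow⇒integral : ∀ {x} → 0# ≤ x → InWindow x →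
                        Σ[ e ∈ Expansion b b#0 Domain IsDigits x ] Expansion.IsIntegral e
    inWindow⇒integral {x} 0≤x (w , x≈w , 0≤ψw , ψw<τ²) = expansion , λ j K-j<0 →
      d≡0 j (ℕ.≰⇒> λ j≤K → ℤ.<⇒≱ K-j<0 (ℤ.i≤j⇒0≤j-i (+≤+ j≤K)))
      where
      -- Dividing by the power `suc K` of the base places the first `suc K` digits in positions `K`
      -- to 0, so the point reached after them is the fractional remainder.
      K = proj₁ (shrink x 0≤x)
      y = φ B⁻¹ ^ suc K * x

      y∈D : Domain y
      y∈D = proj₂ (shrink x 0≤x)

      u = proj₁ (φ-B⁻¹-multiple (suc K) w)

      u≈y : φ u ≈ y
      u≈y = trans (proj₂ (φ-B⁻¹-multiple (suc K) w)) (CR.*-congˡ (sym x≈w))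

      s : ℕ → State
      s = orbit (state {u} (admissible-resp (sym u≈y) CR.refl (initial y∈D)))

      d : ℕ → ℤ
      d i = proj₁ (next-digit (s i))

      isDigits : IsDigits y d
      isDigits = (λ i → φ (element (s i))) , u≈y , λ i → proj₂ (next-digit (s i)) ,
        trans (φ-next (element (s i)) (d i))
          (CR.+-cong (CR.*-congʳ (sym b≈φB)) (CR.-‿cong (φ-ι (d i))))

      t = proj₁ isDigits
      h = horner B d (suc K)

      w≈h+t : φ w ≈ φ h + t (suc K)
      w≈h+t = begin
        φ w                                          ≈⟨ x≈w ⟨
        x                                            ≈⟨ CR.*-identityˡ x ⟨
        1# * x                                       ≈⟨ CR.*-congʳ (1^n (suc K)) ⟨
        1# ^ suc K * x                               ≈⟨ CR.*-congʳ (^-congˡ (suc K) B*B⁻¹≈1) ⟨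
        (φ B * φ B⁻¹) ^ suc K * x                    ≈⟨ CR.*-congʳ (^-distrib-* _ _ (suc K)) ⟩
        φ B ^ suc K * φ B⁻¹ ^ suc K * x              ≈⟨ CR.*-assoc _ _ _ ⟩
        φ B ^ suc K * y                              ≈⟨ scaled isDigits (suc K) ⟩
        φ h + t (suc K)                              ∎
        where
        1^n : ∀ n → 1# ^ n ≈ 1#
        1^n zero    = CR.refl
        1^n (suc n) = trans (CR.*-identityˡ _) (1^n n)

      w-h≈t : φ (w ⊝ h) ≈ t (suc K)
      w-h≈t = trans (φ-⊝ w h) (trans (CR.+-congʳ w≈h+t)
        (solve 2 (λ h t → (h :+ t) :- h := t) CR.refl (φ h) (t (suc K))))
        where open ℤ-Solver

      -- A `State` does not tie its image to the digits; `digits-admissible` recovers the invariant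
      -- with the conjugate of `h` in the second place.
      w-h≈0 : φ (w ⊝ h) ≈ 0#
      w-h≈0 = remainder≈0 w h
        (admissible-resp (sym w-h≈t) CR.refl (digits-admissible y∈D isDigits (suc K))) 0≤ψw ψw<τ²

      d≡0 : ∀ j → K ℕ.< j → d j ≡ 0ℤ
      d≡0 = digits-vanish isDigits (suc K) (trans (sym w-h≈t) w-h≈0)

      h≈x : φ h ≈ x
      h≈x = begin
        φ h                 ≈⟨ CR.+-identityʳ _ ⟨
        φ h + 0#            ≈⟨ CR.+-congˡ (trans (sym w-h≈t) w-h≈0) ⟨
        φ h + t (suc K)     ≈⟨ w≈h+t ⟨
        φ w                 ≈⟨ x≈w ⟨
        x                   ∎

      expansion : Expansion b b#0 Domain IsDigits x
      expansion = record
        { k        = + K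
        ; digit    = d
        ; y        = y
        ; y∈Domain = y∈D
        ; isDigits = isDigits
        ; hasSum   = eventually-≈⇒⟶ (suc K) λ n K<n → trans (expansion-sum K d d≡0 n K<n) h≈x
        }

  1<τ² : 1# < τ * τ
  1<τ² = 1<x*y 1<τ 1<τ

  -- Base τ²

  module SquareBase where

    open Positive (τ * τ) 1<τ²
    open ℤ[τ]-Solver

    τ*τ≈ : τ * τ ≈ φ 𝛕²
    τ*τ≈ = trans (CR.*-cong (sym φ-𝛕) (sym φ-𝛕)) (sym (φ-⊗ 𝛕 𝛕))

    -- In the natural extension of T_{τ²} the fibre over [0 , τ⁻¹) is [0 , τ²)
    -- and the fibre over [τ⁻¹ , 1) is [0 , τ).
    record Admissible (t z : Carrier) : Set (ℓ₁ ⊔ˡ ℓ₂) where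
      constructor admissible
      field
        0≤t   : φ 𝟘 ≤ t
        t<1   : t < φ 𝟙
        0≤z   : φ 𝟘 ≤ z
        z<τ²  : z < φ 𝛕²
        upper : φ 𝛕⁻¹ ≤ t → z < φ 𝛕

    admissible-resp : ∀ {t t′ z z′} → t ≈ t′ → z ≈ z′ → Admissible t z → Admissible t′ z′
    admissible-resp t≈ z≈ (admissible a b c d e) = admissible (≤-respʳ t≈ a) (<-respˡ t≈ b)
      (≤-respʳ z≈ c) (<-respˡ z≈ d) λ τ⁻¹≤t → <-respˡ z≈ (e (≤-respʳ (sym t≈) τ⁻¹≤t))

    initial : ∀ {y} → Domain y → Admissible y (φ 𝟘)
    initial (0≤y , y<1) = admissible (≤-respˡ (sym (φ-ι 0ℤ)) 0≤y) (<-respʳ (sym φ-𝟙) y<1)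
      ≤-refl (<φ 𝟘 𝛕²) λ _ → <φ 𝟘 𝛕

    module Step {t z : Carrier} {d : ℤ} (admissible-tz : Admissible t z)
                (floor : IsFloor (τ * τ * t) d) where
      open Admissible admissible-tz

      τ²t-bounds : φ (ι d) ≤ φ 𝛕² * t × φ 𝛕² * t < φ (ι d) + φ 𝟙
      τ²t-bounds = floor-φ {d = d} (CR.*-congʳ τ*τ≈) floor

      0<τ² : 0# < φ 𝛕²
      0<τ² = <-respˡ (φ-ι 0ℤ) (<φ 𝟘 𝛕²)

      d-bounds : 0ℤ ℤ.≤ d × d ℤ.< + 3
      d-bounds = digit-bounds floor
        (≤-respˡ (trans (CR.*-congˡ (φ-ι 0ℤ)) (trans (CR.zeroʳ _) (sym (φ-ι 0ℤ))))
          (≤-respʳ (CR.*-congʳ (sym τ*τ≈)) (*-monoʳ-≤ 0<τ² 0≤t)))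
        (<-respˡ (CR.*-congʳ (sym τ*τ≈))
          (<.trans (*-monoʳ-< 0<τ² t<1) (<-respˡ (φ-⊗ 𝛕² 𝟙) (<φ (𝛕² ⊗ 𝟙) (ι (+ 3))))))

      0≤d = proj₁ d-bounds
      d<3 = proj₂ d-bounds

      0≤t′ : φ 𝟘 ≤ φ 𝛕² * t - φ (ι d)
      0≤t′ = ≤-shift (proj₁ τ²t-bounds)
        (solve 2 (λ t d → con 𝛕² :* t :- d := (con 𝛕² :* t :- d) :- con 𝟘) CR.refl t (φ (ι d)))

      t′<1 : φ 𝛕² * t - φ (ι d) < φ 𝟙
      t′<1 = <-shift (proj₂ τ²t-bounds)
        (solve 2 (λ t d → (d :+ con 𝟙) :- con 𝛕² :* t := con 𝟙 :- (con 𝛕² :* t :- d))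
          CR.refl t (φ (ι d)))

      -- Pulls a lower bound on the next point back through t = τ⁻² (t′ + d), in order to locate `t`
      -- in the upper part of the domain.
      τ⁻¹≤t : ∀ q d → φ 𝛕⁻¹ ≤ φ (𝛕⁻² ⊗ (q ⊕ ι d)) → φ q ≤ φ 𝛕² * t - φ (ι d) → φ 𝛕⁻¹ ≤ t
      τ⁻¹≤t q d τ⁻¹≤ q≤t′ = ≤-trans τ⁻¹≤ (≤-respˡ
        (sym (trans (φ-⊗ 𝛕⁻² (q ⊕ ι d)) (CR.*-congˡ (φ-⊕ q (ι d)))))
        (≤-shift (*-monoʳ-≤ 0<τ⁻² q≤t′)
          (solve 3 (λ t d q →
            con 𝛕⁻² :* (con 𝛕² :* t :- d) :- con 𝛕⁻² :* q := t :- con 𝛕⁻² :* (q :+ d))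
            CR.refl t (φ (ι d)) (φ q))))

      -- The digit 2 is emitted only from the upper part, because 2 τ⁻² > τ⁻¹.
      2≤τ²t⇒z<τ : φ (ι (+ 2)) ≤ φ 𝛕² * t → z < φ 𝛕
      2≤τ²t⇒z<τ 2≤τ²t = upper (τ⁻¹≤t 𝟘 (+ 2) (<⇒≤ (<φ 𝛕⁻¹ (𝛕⁻² ⊗ (𝟘 ⊕ ι (+ 2)))))
        (≤-shift 2≤τ²t (solve 1 (λ t →
          con 𝛕² :* t :- con (ι (+ 2)) := (con 𝛕² :* t :- con (ι (+ 2))) :- con 𝟘) CR.refl t)))

      -- For the digits 0 and 1 the bound z < τ² suffices, giving 1 and 2. For the digit 2 it would
      -- only give 3, so the sharper bound τ is used, and τ⁻² τ + 2 = τ² is exact.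
      z′<τ² : ∀ d → 0ℤ ℤ.≤ d → d ℤ.< + 3 → φ (ι d) ≤ φ 𝛕² * t → φ 𝛕⁻² * z + φ (ι d) < φ 𝛕²
      z′<τ² (+ 0) _ _ _ = <.trans (affine-< 𝛕⁻² 𝛕² 0ℤ 0<τ⁻² z<τ²) (<φ (𝛕⁻² ⊗ 𝛕² ⊕ 𝟘) 𝛕²)
      z′<τ² (+ 1) _ _ _ = <.trans (affine-< 𝛕⁻² 𝛕² 1ℤ 0<τ⁻² z<τ²) (<φ (𝛕⁻² ⊗ 𝛕² ⊕ 𝟙) 𝛕²)
      z′<τ² (+ 2) _ _ 2≤τ²t = affine-< 𝛕⁻² 𝛕 (+ 2) 0<τ⁻² (2≤τ²t⇒z<τ 2≤τ²t)
      z′<τ² (+ suc (suc (suc _))) _ (+<+ (s<s (s<s (s<s ()))))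
      z′<τ² -[1+ _ ] ()

      -- Digit 0 gives at most 1 < τ. With digit 1, t ≥ τ⁻² (τ⁻¹ + 1) = τ⁻¹, so `t` was already in
      -- the upper part and τ⁻² τ + 1 = τ. Digit 2 cannot lead there, since t′ < τ² - 2 = τ⁻¹.
      upper′ : ∀ d → 0ℤ ℤ.≤ d → d ℤ.< + 3 → φ (ι d) ≤ φ 𝛕² * t →
               φ 𝛕⁻¹ ≤ φ 𝛕² * t - φ (ι d) → φ 𝛕⁻² * z + φ (ι d) < φ 𝛕
      upper′ (+ 0) _ _ _ _ = <.trans (affine-< 𝛕⁻² 𝛕² 0ℤ 0<τ⁻² z<τ²) (<φ (𝛕⁻² ⊗ 𝛕² ⊕ 𝟘) 𝛕)
      upper′ (+ 1) _ _ _ τ⁻¹≤t′ = affine-< 𝛕⁻² 𝛕 1ℤ 0<τ⁻² (upper (τ⁻¹≤t 𝛕⁻¹ 1ℤ ≤-refl τ⁻¹≤t′))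
      upper′ (+ 2) _ _ _ τ⁻¹≤t′ = ⊥-elim (τ⁻¹≤t′ (<-shift (*-monoʳ-< 0<τ² t<1)
        (solve 1 (λ t →
          con 𝛕² :* con 𝟙 :- con 𝛕² :* t := con 𝛕⁻¹ :- (con 𝛕² :* t :- con (ι (+ 2)))) CR.refl t)))
      upper′ (+ suc (suc (suc _))) _ (+<+ (s<s (s<s (s<s ()))))
      upper′ -[1+ _ ] ()

    step : ∀ {t z d} → Admissible t z → IsFloor (τ * τ * t) d →
           Admissible (φ 𝛕² * t - φ (ι d)) (ψ 𝛕² * z + φ (ι d))
    step {t} {z} {d} admissible-tz floor =
      admissible 0≤t′ t′<1
        (affine-nonneg 𝛕⁻² 0<τ⁻² (Admissible.0≤z admissible-tz) 0≤d)
        (z′<τ² d 0≤d d<3 (proj₁ τ²t-bounds))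
        (upper′ d 0≤d d<3 (proj₁ τ²t-bounds))
      where open Step {t} {z} {d} admissible-tz floor

    digit-exists : ∀ u {z} → Admissible (φ u) z → ∃[ d ] IsFloor (τ * τ * φ u) d
    digit-exists u adm = floor-exists (compare (𝛕² ⊗ u) τ²u≈)
      (≤-respˡ (CR.zeroʳ _) (*-monoʳ-≤ (1<β⇒0<β 1<τ²) (≤-respˡ (φ-ι 0ℤ) (Admissible.0≤t adm))))
      where
      τ²u≈ : τ * τ * φ u ≈ φ (𝛕² ⊗ u)
      τ²u≈ = trans (CR.*-congʳ τ*τ≈) (sym (φ-⊗ 𝛕² u))

    digit-of-0 : ∀ {t d} → t ≈ 0# → IsFloor (τ * τ * t) d → d ≡ 0ℤ
    digit-of-0 t≈0 = floor-of-fraction (≤-respʳ (sym τ²t≈0) ≤-refl) (<-respˡ (sym τ²t≈0) (<φ 𝟘 𝟙))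
      where τ²t≈0 = trans (CR.*-congˡ t≈0) (trans (CR.zeroʳ _) (sym (φ-ι 0ℤ)))

    -- The candidate -τ⁻¹ is negative. The candidate τ⁻¹ has conjugate -τ, but over t = τ⁻¹ the
    -- conjugate of `h` is below τ, while that of `w` is nonnegative.
    remainder≈0 : ∀ w h → Admissible (φ (w ⊝ h)) (ψ h) → φ 𝟘 ≤ ψ w → ψ w < φ 𝛕² →
                  φ (w ⊝ h) ≈ 0#
    remainder≈0 w h (admissible 0≤t t<1 0≤z z<τ² upper) 0≤ψw ψw<τ² =
      [ (λ v≡0 → trans (reflexive (≡.cong φ v≡0)) (φ-ι 0ℤ)) , [ ≢τ⁻¹ , ≢-τ⁻¹ ]′ ]′
        (strip-elements (w ⊝ h) (≤-trans (<⇒≤ (<φ (⊖ 𝛕⁻¹) 𝟘)) 0≤t) t<1 (proj₁ ψ-bounds) (proj₂ ψ-bounds))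
      where
      ψ-bounds : φ (⊖ 𝛕²) < ψ (w ⊝ h) × ψ (w ⊝ h) < φ 𝛕²
      ψ-bounds = conj-remainder w h 0≤z z<τ² 0≤ψw ψw<τ²

      ≢-τ⁻¹ : w ⊝ h ≡ ⊖ 𝛕⁻¹ → φ (w ⊝ h) ≈ 0#
      ≢-τ⁻¹ v≡-τ⁻¹ = ⊥-elim (≤-respʳ (reflexive (≡.cong φ v≡-τ⁻¹)) 0≤t (<φ (⊖ 𝛕⁻¹) 𝟘))

      ≢τ⁻¹ : w ⊝ h ≡ 𝛕⁻¹ → φ (w ⊝ h) ≈ 0#
      ≢τ⁻¹ v≡τ⁻¹ = ⊥-elim (<.irrefl CR.refl (<-respʳ (reflexive (≡.cong ψ v≡τ⁻¹)) -τ<ψ))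
        where
        -τ<ψ : φ (⊖ 𝛕) < ψ (w ⊝ h)
        -τ<ψ = <-respʳ (sym (ψ-⊝ w h))
          (<-shift (+-mono-<-≤ (upper (≤-respʳ (reflexive (≡.cong φ (≡.sym v≡τ⁻¹))) ≤-refl)) 0≤ψw)
            (solve 2 (λ w h → (con 𝛕 :+ w) :- (h :+ con 𝟘) := (w :- h) :- con (⊖ 𝛕))
              CR.refl (ψ w) (ψ h)))

    shrink : ∀ x → 0# ≤ x → ∃[ K ] Domain (φ 𝛕⁻² ^ suc K * x)
    shrink x 0≤x = map₂ (map₂ λ y<τ⁻² → <.trans y<τ⁻² (<-respʳ φ-𝟙 (<φ 𝛕⁻² 𝟙))) (shrink-τ⁻² x 0≤x)

    system : System (τ * τ) (β#0 1<τ²) Domain (λ y n → IsFloor (τ * τ * y) n)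
    system = record
      { B               = 𝛕²
      ; B⁻¹             = 𝛕⁻²
      ; b≈φB            = τ*τ≈
      ; B*B⁻¹≈1         = trans (sym (φ-⊗ 𝛕² 𝛕⁻²)) φ-𝟙
      ; Admissible      = Admissible
      ; admissible-resp = admissible-resp
      ; initial         = initial
      ; step            = λ {t} {z} {d} → step {t} {z} {d}
      ; window          = λ adm → Admissible.0≤z adm , Admissible.z<τ² adm
      ; digit-exists    = digit-exists
      ; digit-of-0      = λ {t} {d} → digit-of-0 {t} {d}
      ; remainder≈0     = remainder≈0
      ; shrink          = shrink
      }

  -- Base -τ

  module NegativeBase where

    open Negative τ 1<τ
    open ℤ[τ]-Solver
    open Exp CR.commutativeSemiring using (^-congˡ; ^-assocʳ)

    -τ≈ : - τ ≈ φ (⊖ 𝛕)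
    -τ≈ = trans (CR.-‿cong (sym φ-𝛕)) (sym (φ-⊖ 𝛕))

    -- τ / (τ + 1) = τ⁻¹ because (τ + 1) τ⁻¹ = τ; this brings the endpoints into ℤ[τ].
    l≈ : lβ ≈ φ (⊖ 𝛕⁻¹)
    l≈ = trans (CR.-‿cong (begin
      τ * p                        ≈⟨ CR.*-congʳ φ-𝛕 ⟨
      φ 𝛕 * p
        ≈⟨ solve 1 (λ p → con 𝛕 :* p := (p :* (con 𝛕 :+ con 𝟙)) :* con 𝛕⁻¹) CR.refl p ⟩
      p * (φ 𝛕 + φ 𝟙) * φ 𝛕⁻¹      ≈⟨ CR.*-congʳ (CR.*-congˡ (CR.+-cong φ-𝛕 φ-𝟙)) ⟩
      p * (τ + 1#) * φ 𝛕⁻¹         ≈⟨ CR.*-congʳ (inv-inverseˡ (β+1#0 1<τ)) ⟩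
      1# * φ 𝛕⁻¹                   ≈⟨ CR.*-identityˡ _ ⟩
      φ 𝛕⁻¹                        ∎)) (sym (φ-⊖ 𝛕⁻¹))
      where p = inv (τ + 1#) (β+1#0 1<τ)

    r≈ : rβ ≈ φ 𝛕⁻²
    r≈ = trans (CR.+-cong (sym φ-𝟙) l≈) (sym (φ-⊕ 𝟙 (⊖ 𝛕⁻¹)))

    Digit : Carrier → ℤ → Set ℓ₂
    Digit t d = IsFloor (- τ * t - lβ) d

    shifted : Carrier → Carrier
    shifted t = φ (⊖ 𝛕) * t - φ (⊖ 𝛕⁻¹)

    shifted≈ : ∀ t → - τ * t - lβ ≈ shifted t
    shifted≈ t = CR.+-cong (CR.*-congʳ -τ≈) (CR.-‿cong l≈)

    -- The endpoint l = −τ⁻¹ of the domain of T is reached only through a digit 1,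
    -- after which the conjugate is at least 1.
    record Admissible (t z : Carrier) : Set (ℓ₁ ⊔ˡ ℓ₂) where
      constructor admissible
      field
        l≤t   : φ (⊖ 𝛕⁻¹) ≤ t
        t<r   : t < φ 𝛕⁻²
        0≤z   : φ 𝟘 ≤ z
        z<τ²  : z < φ 𝛕²
        lower : t ≤ φ (⊖ 𝛕⁻¹) → φ 𝟙 ≤ z

    admissible-resp : ∀ {t t′ z z′} → t ≈ t′ → z ≈ z′ → Admissible t z → Admissible t′ z′
    admissible-resp t≈ z≈ (admissible a b c d e) = admissible (≤-respʳ t≈ a) (<-respˡ t≈ b)
      (≤-respʳ z≈ c) (<-respˡ z≈ d) λ t≤l → ≤-respʳ z≈ (e (≤-respˡ (sym t≈) t≤l))

    initial : ∀ {y} → Domain y → Admissible y (φ 𝟘)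
    initial (l<y , y<r) = admissible (<⇒≤ (<-respˡ l≈ l<y)) (<-respʳ r≈ y<r)
      ≤-refl (<φ 𝟘 𝛕²) λ y≤l → ⊥-elim (y≤l (<-respˡ l≈ l<y))

    0<τ′ : 0# < φ 𝛕
    0<τ′ = <-respˡ (φ-ι 0ℤ) (<φ 𝟘 𝛕)

    -- The bound is strict because the right endpoint τ⁻² is excluded, and this strictness is what
    -- prevents a digit 0 from leading to the left endpoint.
    0<shifted : ∀ {t} → t < φ 𝛕⁻² → φ 𝟘 < shifted t
    0<shifted {t} t<r = <-shift (*-monoʳ-< 0<τ′ t<r)
      (solve 1 (λ t →
        con 𝛕 :* con 𝛕⁻² :- con 𝛕 :* t := (con (⊖ 𝛕) :* t :- con (⊖ 𝛕⁻¹)) :- con 𝟘) CR.refl t)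

    shifted≤τ : ∀ {t} → φ (⊖ 𝛕⁻¹) ≤ t → shifted t ≤ φ 𝛕
    shifted≤τ {t} l≤t = ≤-shift (*-monoʳ-≤ 0<τ′ l≤t)
      (solve 1 (λ t →
        con 𝛕 :* t :- con 𝛕 :* con (⊖ 𝛕⁻¹) := con 𝛕 :- (con (⊖ 𝛕) :* t :- con (⊖ 𝛕⁻¹))) CR.refl t)

    module Step {t z : Carrier} {d : ℤ} (admissible-tz : Admissible t z) (floor : Digit t d) where
      open Admissible admissible-tz

      bounds : φ (ι d) ≤ shifted t × shifted t < φ (ι d) + φ 𝟙
      bounds = floor-φ {d = d} (shifted≈ t) floor

      d-bounds : 0ℤ ℤ.≤ d × d ℤ.< + 2
      d-bounds = digit-bounds floor
        (≤-respʳ (sym (shifted≈ t)) (<⇒≤ (0<shifted t<r)))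
        (<-respˡ (sym (shifted≈ t)) (≤-<-trans (shifted≤τ l≤t) (<φ 𝛕 (ι (+ 2)))))

      l≤t′ : φ (⊖ 𝛕⁻¹) ≤ φ (⊖ 𝛕) * t - φ (ι d)
      l≤t′ = ≤-shift (proj₁ bounds)
        (solve 2 (λ t d →
          (con (⊖ 𝛕) :* t :- con (⊖ 𝛕⁻¹)) :- d := (con (⊖ 𝛕) :* t :- d) :- con (⊖ 𝛕⁻¹))
          CR.refl t (φ (ι d)))

      t′<r : φ (⊖ 𝛕) * t - φ (ι d) < φ 𝛕⁻²
      t′<r = <-shift (proj₂ bounds)
        (solve 2 (λ t d →
          (d :+ con 𝟙) :- (con (⊖ 𝛕) :* t :- con (⊖ 𝛕⁻¹)) := con 𝛕⁻² :- (con (⊖ 𝛕) :* t :- d))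
          CR.refl t (φ (ι d)))

      -- The window is τ² because it is the fixed point of z ↦ τ⁻¹ z + 1, the conjugate action of
      -- the largest digit.
      z′<τ² : ∀ d → 0ℤ ℤ.≤ d → d ℤ.< + 2 → φ 𝛕⁻¹ * z + φ (ι d) < φ 𝛕²
      z′<τ² (+ 0) _ _ = <.trans (affine-< 𝛕⁻¹ 𝛕² 0ℤ 0<τ⁻¹ z<τ²) (<φ (𝛕⁻¹ ⊗ 𝛕² ⊕ 𝟘) 𝛕²)
      z′<τ² (+ 1) _ _ = affine-< 𝛕⁻¹ 𝛕² 1ℤ 0<τ⁻¹ z<τ²
      z′<τ² (+ suc (suc _)) _ (+<+ (s<s (s<s ())))
      z′<τ² -[1+ _ ] ()

      lower′ : ∀ d → 0ℤ ℤ.≤ d → d ℤ.< + 2 →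
               φ (⊖ 𝛕) * t - φ (ι d) ≤ φ (⊖ 𝛕⁻¹) → φ 𝟙 ≤ φ 𝛕⁻¹ * z + φ (ι d)
      lower′ (+ 0) _ _ t′≤l = ⊥-elim (t′≤l (<-shift (0<shifted t<r)
        (solve 1 (λ t →
          (con (⊖ 𝛕) :* t :- con (⊖ 𝛕⁻¹)) :- con 𝟘 := (con (⊖ 𝛕) :* t :- con 𝟘) :- con (⊖ 𝛕⁻¹))
          CR.refl t)))
      lower′ (+ 1) _ _ _ = ≤-shift (*-monoʳ-≤ 0<τ⁻¹ 0≤z)
        (solve 1 (λ z → con 𝛕⁻¹ :* z :- con 𝛕⁻¹ :* con 𝟘 := (con 𝛕⁻¹ :* z :+ con 𝟙) :- con 𝟙) CR.refl z)
      lower′ (+ suc (suc _)) _ (+<+ (s<s (s<s ())))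
      lower′ -[1+ _ ] ()

    step : ∀ {t z d} → Admissible t z → Digit t d →
           Admissible (φ (⊖ 𝛕) * t - φ (ι d)) (ψ (⊖ 𝛕) * z + φ (ι d))
    step {t} {z} {d} admissible-tz floor =
      admissible l≤t′ t′<r (affine-nonneg 𝛕⁻¹ 0<τ⁻¹ (Admissible.0≤z admissible-tz) (proj₁ d-bounds))
        (z′<τ² d (proj₁ d-bounds) (proj₂ d-bounds)) (lower′ d (proj₁ d-bounds) (proj₂ d-bounds))
      where open Step {t} {z} {d} admissible-tz floor

    digit-exists : ∀ u {z} → Admissible (φ u) z → ∃[ d ] Digit (φ u) d
    digit-exists u adm = floor-exists (compare (⊖ 𝛕 ⊗ u ⊝ ⊖ 𝛕⁻¹) shifted-u≈)
      (≤-respˡ (φ-ι 0ℤ) (≤-respʳ (sym (shifted≈ (φ u))) (<⇒≤ (0<shifted (Admissible.t<r adm)))))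
      where
      shifted-u≈ : - τ * φ u - lβ ≈ φ (⊖ 𝛕 ⊗ u ⊝ ⊖ 𝛕⁻¹)
      shifted-u≈ = trans (shifted≈ (φ u))
        (sym (trans (φ-⊝ (⊖ 𝛕 ⊗ u) (⊖ 𝛕⁻¹)) (CR.+-congʳ (φ-⊗ (⊖ 𝛕) u))))

    digit-of-0 : ∀ {t d} → t ≈ 0# → Digit t d → d ≡ 0ℤ
    digit-of-0 {t} t≈0 = floor-of-fraction
      (≤-respʳ (sym (shifted≈ t)) (<⇒≤ (0<shifted (<-respˡ (sym t≈0) 0<τ⁻²))))
      (<-respˡ (sym shifted-t≈) (<φ 𝛕⁻¹ 𝟙))
      where
      shifted-t≈ : - τ * t - lβ ≈ φ 𝛕⁻¹
      shifted-t≈ = trans (shifted≈ t) (trans (CR.+-congʳ (CR.*-congˡ (trans t≈0 (sym (φ-ι 0ℤ)))))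
        (solve 0 (con (⊖ 𝛕) :* con 𝟘 :- con (⊖ 𝛕⁻¹) := con 𝛕⁻¹) CR.refl))

    -- The candidate τ⁻¹ lies beyond the right endpoint τ⁻². The candidate -τ⁻¹ is the left endpoint
    -- and has conjugate τ, but there the conjugate of `h` is at least 1, so the difference stays
    -- below τ² - 1 = τ.
    remainder≈0 : ∀ w h → Admissible (φ (w ⊝ h)) (ψ h) → φ 𝟘 ≤ ψ w → ψ w < φ 𝛕² →
                  φ (w ⊝ h) ≈ 0#
    remainder≈0 w h (admissible l≤t t<r 0≤z z<τ² lower) 0≤ψw ψw<τ² =
      [ (λ v≡0 → trans (reflexive (≡.cong φ v≡0)) (φ-ι 0ℤ)) , [ ≢τ⁻¹ , ≢-τ⁻¹ ]′ ]′
        (strip-elements (w ⊝ h) l≤t (<.trans t<r (<φ 𝛕⁻² 𝟙)) (proj₁ ψ-bounds) (proj₂ ψ-bounds))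
      where
      ψ-bounds : φ (⊖ 𝛕²) < ψ (w ⊝ h) × ψ (w ⊝ h) < φ 𝛕²
      ψ-bounds = conj-remainder w h 0≤z z<τ² 0≤ψw ψw<τ²

      ≢τ⁻¹ : w ⊝ h ≡ 𝛕⁻¹ → φ (w ⊝ h) ≈ 0#
      ≢τ⁻¹ v≡τ⁻¹ = ⊥-elim (<.asym (<-respˡ (reflexive (≡.cong φ v≡τ⁻¹)) t<r) (<φ 𝛕⁻² 𝛕⁻¹))

      ≢-τ⁻¹ : w ⊝ h ≡ ⊖ 𝛕⁻¹ → φ (w ⊝ h) ≈ 0#
      ≢-τ⁻¹ v≡-τ⁻¹ = ⊥-elim (<.irrefl CR.refl (<-respˡ (reflexive (≡.cong ψ v≡-τ⁻¹)) ψ<τ))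
        where
        ψ<τ : ψ (w ⊝ h) < φ 𝛕
        ψ<τ = <-respˡ (sym (ψ-⊝ w h))
          (<-shift (+-mono-<-≤ ψw<τ² (lower (≤-respˡ (reflexive (≡.cong φ (≡.sym v≡-τ⁻¹))) ≤-refl)))
            (solve 2 (λ w h → (con 𝛕² :+ h) :- (w :+ con 𝟙) := con 𝛕 :- (w :- h))
              CR.refl (ψ w) (ψ h)))

    -- An even exponent makes the power of -τ⁻¹ a power of τ⁻², so the scaled point is nonnegative
    -- and below the right endpoint τ⁻². The witness is chosen so that its successor is `2 * suc n`
    -- by computation.
    shrink : ∀ x → 0# ≤ x → ∃[ K ] Domain (φ (⊖ 𝛕⁻¹) ^ suc K * x)
    shrink x 0≤x = n ℕ.+ suc (n ℕ.+ 0) ,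
      <-respˡ (sym l≈) (<-≤-trans (<-respʳ (φ-ι 0ℤ) (<φ (⊖ 𝛕⁻¹) 𝟘)) (≤-respʳ y≈ (proj₁ bounds))) ,
      <-respʳ (sym r≈) (<-respˡ y≈ (proj₂ bounds))
      where
      n = proj₁ (shrink-τ⁻² x 0≤x)
      bounds = proj₂ (shrink-τ⁻² x 0≤x)

      square : φ (⊖ 𝛕⁻¹) ^ 2 ≈ φ 𝛕⁻²
      square = trans (CR.*-congˡ (CR.*-identityʳ _)) (sym (φ-⊗ (⊖ 𝛕⁻¹) (⊖ 𝛕⁻¹)))

      y≈ : φ 𝛕⁻² ^ suc n * x ≈ φ (⊖ 𝛕⁻¹) ^ (2 ℕ.* suc n) * x
      y≈ = CR.*-congʳ (trans (^-congˡ (suc n) (sym square)) (^-assocʳ (φ (⊖ 𝛕⁻¹)) 2 (suc n)))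

    system : System (- τ) (-β#0 1<τ) Domain Digit
    system = record
      { B               = ⊖ 𝛕
      ; B⁻¹             = ⊖ 𝛕⁻¹
      ; b≈φB            = -τ≈
      ; B*B⁻¹≈1         = trans (sym (φ-⊗ (⊖ 𝛕) (⊖ 𝛕⁻¹))) φ-𝟙
      ; Admissible      = Admissible
      ; admissible-resp = admissible-resp
      ; initial         = initial
      ; step            = λ {t} {z} {d} → step {t} {z} {d}
      ; window          = λ adm → Admissible.0≤z adm , Admissible.z<τ² adm
      ; digit-exists    = digit-exists
      ; digit-of-0      = λ {t} {d} → digit-of-0 {t} {d}
      ; remainder≈0     = remainder≈0
      ; shrink          = shrink
      }

  -- Comparison of the two sets

  inWindow-resp : ∀ {x y} → x ≈ y → InWindow x → InWindow y
  inWindow-resp x≈y (w , x≈w , bounds) = w , trans (sym x≈y) x≈w , bounds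

  -- Each inclusion passes through `InWindow`. The positive base expands the absolute value, which
  -- is traded for the number itself on the half-line.
  -τ-integers≐τ²-integers : ℤ[- τ , 1<τ ] ∩ [0,+∞⟩ ≐ ℤ[ τ * τ , 1<τ² ] ∩ [0,+∞⟩
  -τ-integers≐τ²-integers =
    (λ ((e , integral) , 0≤x) →
      inWindow⇒integral SquareBase.system (≤-respʳ (sym (∣x∣≈x 0≤x)) 0≤x)
        (inWindow-resp (sym (∣x∣≈x 0≤x)) (integral⇒inWindow NegativeBase.system e integral)) , 0≤x) ,
    (λ ((e , integral) , 0≤x) →
      inWindow⇒integral NegativeBase.system 0≤x
        (inWindow-resp (∣x∣≈x 0≤x) (integral⇒inWindow SquareBase.system e integral)) , 0≤x)

theorem7p3 : ∀ {c ℓ₁ ℓ₂ : Level} (ℝ : RealField c ℓ₁ ℓ₂) →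
    let open Expansions ℝ in
    (√5 : Carrier) (√5-root : IsSquareRoot (fromℤ (+ 5)) √5) →
    let τ    = goldenRatio √5
        1<τ  = 1<goldenRatio √5-root
        1<τ² = 1<x*y 1<τ 1<τ
    in ℤ[- τ , 1<τ ] ∩ [0,+∞⟩ ≐ ℤ[ τ * τ , 1<τ² ] ∩ [0,+∞⟩
theorem7p3 ℝ √5 √5-root = CutAndProject.-τ-integers≐τ²-integers ℝ √5 √5-root
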